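{- Let $M\in\mathbb{N}$. Assume that a nonempty set $A\subset\mathbb{Z}_M$ satisfies (T1) and (T2), and that $M$ has at most two distinct prime divisors. Then $A(X)$ cannot have unsupported cyclotomic divisors.
   Context: $\mathbb{Z}_M=\mathbb{Z}/M\mathbb{Z}$. For $A\subset\mathbb{Z}_M$, represent its elements by integers in $\{0,1,\dots,M-1\}$; the mask polynomial is $A(X)=\sum_{a\in A}X^a$, considered modulo $X^M-1$. For $s\mid M$, divisibility of $A(X)$ by the $s$-th cyclotomic polynomial $\Phi_s(X)$ is well defined, since $\Phi_s\mid X^M-1$; all cyclotomic divisors $\Phi_s$ considered have $s\mid M$. $S_A^*$ is the set of all prime powers $p^\alpha>1$ (with $p^\alpha\mid M$) such that $\Phi_{p^\alpha}(X)\mid A(X)$. Conditions: (T1) $|A|=\prod_{s\in S_A^*}\Phi_s(1)$; (T2) if $s_1,\dots,s_k\in S_A^*$ are powers of distinct primes, then $\Phi_{s_1\cdots s_k}(X)$ divides $A(X)$. If $s\neq1$ and $\Phi_s\mid A$, then $\Phi_s$ is called an unsupported divisor of $A$ if (i) for every prime $p\mid s$ we have $p\mid |A|$, and (ii) for every prime power $p^\alpha$ with $p^\alpha\parallel s$ (i.e. $p$ is a prime dividing $s$, $p^\alpha\mid s$ and $p^{\alpha+1}\nmid s$), we have $\Phi_{p^\alpha}\nmid A$. -}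

module Defs where

open import Data.Bool using (true; false; if_then_else_)
open import Data.Fin using (toℕ)
open import Data.Fin.Properties using (toℕ<n)
open import Data.Fin.Subset using (Subset; ∣_∣)
open import Data.Integer as ℤ using (ℤ; +_; 0ℤ; 1ℤ; -1ℤ)
open import Data.List using (List; []; _∷_; _++_; map; foldr; filter; length; replicate; allFin; product)
open import Data.List.Membership.Propositional using (_∈_)
open import Data.List.Relation.Unary.All using (All)
open import Data.List.Relation.Unary.Unique.Propositional using (Unique)
open import Data.Nat using (ℕ; zero; suc; pred; _^_; _≤_; _<_)
open import Data.Nat.Divisibility using (_∣_; _∣?_)
open import Data.Nat.Induction using (<-wellFounded)
open import Data.Nat.Primality using (Prime)
open import Data.Product using (_×_; _,_; ∃; ∃₂; proj₁; proj₂; uncurry)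
open import Data.Vec using (toList)
open import Function using (_⇔_)
open import Induction.WellFounded using (Acc; acc)
open import Relation.Binary.PropositionalEquality using (_≡_; _≢_; refl)
open import Relation.Nullary using (¬_; does)

-- Elements of ℤ[X] are coefficient lists, constant term first.  Trailing zeros
-- are allowed, so equality of polynomials is _≈ₚ_ rather than _≡_.
Poly : Set
Poly = List ℤ

coeff : Poly → ℕ → ℤ
coeff []      _       = 0ℤ
coeff (a ∷ p) zero    = a
coeff (a ∷ p) (suc k) = coeff p k

infix  4 _≈ₚ_ _∣ₚ_
infixl 6 _+ₚ_ _-ₚ_
infixl 7 _*ₚ_ _/ₚ_
infixr 7 _·ₚ_

_≈ₚ_ : Poly → Poly → Set
p ≈ₚ q = ∀ k → coeff p k ≡ coeff q k

_+ₚ_ : Poly → Poly → Poly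
[]      +ₚ q       = q
(a ∷ p) +ₚ []      = a ∷ p
(a ∷ p) +ₚ (b ∷ q) = (a ℤ.+ b) ∷ (p +ₚ q)

_·ₚ_ : ℤ → Poly → Poly
c ·ₚ p = map (c ℤ.*_) p

_-ₚ_ : Poly → Poly → Poly
p -ₚ q = p +ₚ -1ℤ ·ₚ q

_*ₚ_ : Poly → Poly → Poly
[]      *ₚ q = []
(a ∷ p) *ₚ q = a ·ₚ q +ₚ (0ℤ ∷ p *ₚ q)

1ₚ : Poly
1ₚ = 1ℤ ∷ []

∏ₚ : List Poly → Poly
∏ₚ = foldr _*ₚ_ 1ₚ

X^_ : ℕ → Poly
X^ n = replicate n 0ℤ ++ 1ₚ

eval : Poly → ℤ → ℤ
eval []      x = 0ℤ
eval (a ∷ p) x = a ℤ.+ x ℤ.* eval p x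

-- Divisibility in ℤ[X].  For a monic divisor, such as a cyclotomic polynomial,
-- this agrees with divisibility in ℚ[X].
_∣ₚ_ : Poly → Poly → Set
p ∣ₚ q = ∃ λ r → r *ₚ p ≈ₚ q

dropTrailingZeros : Poly → Poly
dropTrailingZeros = foldr cons []
  where
  cons : ℤ → Poly → Poly
  cons a []      = if does (a ℤ.≟ 0ℤ) then [] else a ∷ []
  cons a (b ∷ p) = a ∷ b ∷ p

-- The zero polynomial gets degree 0.
degree : Poly → ℕ
degree p = pred (length (dropTrailingZeros p))

-- Long division by a monic g.  If f = q g + r with deg r < deg g, then
-- a + X f = (c + X q) g + (a + X r - c g), where c is the coefficient of
-- X^(deg g) in a + X r.
quotRem : Poly → Poly → Poly × Poly
quotRem []      g = [] , []
quotRem (a ∷ f) g =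
  let (q , r) = quotRem f g
      c       = coeff (a ∷ r) (degree g)
  in  (c ∷ q) , ((a ∷ r) -ₚ c ·ₚ g)

_/ₚ_ : Poly → Poly → Poly
f /ₚ g = proj₁ (quotRem f g)

-- The cyclotomic polynomials, defined inductively through the identity
--   X^n - 1 = ∏_{d ∣ n} Φ d        (n ≥ 1),
-- that is, Φ n = (X^n - 1) / ∏_{d ∣ n, d < n} Φ d.  The value at n = 0 is junk.
cyclotomic : ∀ n → Acc _<_ n → Poly
cyclotomic n (acc rs) =
  (X^ n -ₚ 1ₚ) /ₚ
  ∏ₚ (map (λ d → cyclotomic (toℕ d) (rs (toℕ<n d)))
          (filter (λ d → toℕ d ∣? n) (allFin n)))

Φ : ℕ → Poly
Φ n = cyclotomic n (<-wellFounded n)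

_ : dropTrailingZeros (Φ 1) ≡ -1ℤ ∷ 1ℤ ∷ []
_ = refl

_ : dropTrailingZeros (Φ 9) ≡ 1ℤ ∷ 0ℤ ∷ 0ℤ ∷ 1ℤ ∷ 0ℤ ∷ 0ℤ ∷ 1ℤ ∷ []
_ = refl

_ : dropTrailingZeros (Φ 12) ≡ 1ℤ ∷ 0ℤ ∷ -1ℤ ∷ 0ℤ ∷ 1ℤ ∷ []
_ = refl

-- A subset of ℤ_M is a Subset M, with a : Fin M standing for the residue class
-- of toℕ a.  A Subset M is a Boolean vector (true = inside), so the coefficient
-- list of ∑_{a ∈ A} X^a is its list of indicator values.
mask : ∀ {M} → Subset M → Poly
mask A = map (λ b → if b then 1ℤ else 0ℤ) (toList A)

IsPrimePower : ℕ → Set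
IsPrimePower s = ∃₂ λ p α → Prime p × 1 ≤ α × s ≡ p ^ α

-- s ∈S* A  is membership of s in S_A^*.
infix 4 _∈S*_
_∈S*_ : ∀ {M} → ℕ → Subset M → Set
_∈S*_ {M} s A = IsPrimePower s × s ∣ M × Φ s ∣ₚ mask A

-- S is an enumeration, without repetition, of the finite set S_A^*.
T1 : ∀ {M} → Subset M → Set
T1 A = ∃ λ (S : List ℕ) →
  Unique S × (∀ s → s ∈ S ⇔ s ∈S* A) ×
  + ∣ A ∣ ≡ foldr ℤ._*_ 1ℤ (map (λ s → eval (Φ s) 1ℤ) S)

-- The list sᵢ = pᵢ ^ αᵢ must be nonempty: for k = 0 the conclusion would read
-- Φ 1 ∣ₚ mask A, which fails for every nonempty A.
T2 : ∀ {M} → Subset M → Set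
T2 A = ∀ (ps : List (ℕ × ℕ)) → ps ≢ [] →
  All (λ (p , α) → Prime p × p ^ α ∈S* A) ps →
  Unique (map proj₁ ps) →
  Φ (product (map (uncurry _^_) ps)) ∣ₚ mask A

-- For p prime: p divides s, and p ^ α ∥ s.
ExactPower : ℕ → ℕ → ℕ → Set
ExactPower p α s = (p ∣ s) × (p ^ α ∣ s) × ¬ (p ^ suc α ∣ s)

record UnsupportedDivisor {M} (A : Subset M) (s : ℕ) : Set where
  field
    s∣M             : s ∣ M
    s≢1             : s ≢ 1
    Φs∣A            : Φ s ∣ₚ mask A
    primes-divide   : ∀ p → Prime p → p ∣ s → p ∣ ∣ A ∣
    no-prime-powers : ∀ p α → Prime p → ExactPower p α s → ¬ (Φ (p ^ α) ∣ₚ mask A)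

AtMostTwoPrimeDivisors : ℕ → Set
AtMostTwoPrimeDivisors M =
  ∀ (ps : List ℕ) → Unique ps → All (λ p → Prime p × p ∣ M) ps → length ps ≤ 2

{-# OPTIONS --safe #-}

-- Write M = pᵐqⁿ, and let K, L be the sets of exponents of the powers of p and
-- of q in S_A^*.  A "p-tree" is a set of residues mod pᵐ whose base p digit at
-- each level i ∈ K (Φ at p^(i+1) divides A) is prescribed by the lower digits,
-- while all digits are allowed at the other levels.  By (T2), vanishing at the
-- levels in K and L means that the numbers of elements of A in products of
-- truncated trees, suitably weighted, are additive on unit squares; with (T1)
-- it follows that every product of a p-tree and a q-tree meets A exactly once.
-- Hence two distinct elements of A never lie in a common product of trees.
--
-- Suppose s = p^(α+1) q^(β+1) is unsupported, so α ∉ K and β ∉ L.  Take the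
-- trees through a₀ ∈ A, truncated after the levels α and β; their product
-- contains P′Q′ points of A, with P′ a power of p and Q′ a power of q.  Fix a
-- p-digit t at level α and a q-digit u at level β different from those of a₀.
-- Then Φ_s ∣ A gives P′Q′ = q·(points with q-digit u) + p·(points with p-digit t),
-- as there is no point with both digits, and by the previous paragraph one of
-- the two terms is 0.  If it is the first, additivity shows that P′ divides the
-- number of points with p-digit t, so that p divides Q′, a contradiction.
module Submission where

open import Algebra.Bundles using (CommutativeRing)
open import Data.Bool using (Bool; true; false; if_then_else_)
open import Data.Empty using (⊥; ⊥-elim)
open import Data.Fin using (Fin; toℕ; zero; suc)
open import Data.Fin.Properties using (toℕ<n)
open import Data.Fin.Subset using (Subset; ∣_∣; Nonempty) renaming (_∈_ to _∈ₛ_)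
open import Data.Integer as ℤ using (ℤ; +_; 0ℤ; 1ℤ; -1ℤ)
import Data.Integer.Properties as ℤ
import Data.Integer.Tactic.RingSolver as ℤ
open import Data.List using (List; []; _∷_; _++_; length; map; foldr; filter; allFin; tabulate; applyDownFrom)
open import Data.List.Membership.Propositional using (_∈_)
open import Data.List.Membership.Propositional.Properties
  using (∈-++⁺ˡ; ∈-++⁺ʳ; ∈-applyDownFrom⁺; ∈-applyDownFrom⁻; ∈-filter⁺; ∈-filter⁻)
open import Data.List.Membership.Propositional.Properties.WithK using (unique∧set⇒bag)
open import Data.List.Properties using (map-cong; map-tabulate; map-++; filter-++)
open import Data.List.Relation.Binary.BagAndSetEquality using (∼bag⇒↭)
open import Data.List.Relation.Binary.Permutation.Propositional as Perm using (_↭_)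
open import Data.List.Relation.Unary.All using ([]; _∷_)
open import Data.List.Relation.Unary.AllPairs using ([]; _∷_)
open import Data.List.Relation.Unary.Unique.Propositional using (Unique)
import Data.List.Relation.Unary.Unique.Propositional.Properties as Unique
open import Data.Nat as ℕ
  using (ℕ; zero; suc; pred; _+_; _*_; _^_; _∸_; _/_; _%_; _≡ᵇ_; _≟_; _≤_; _<_; z≤n; s≤s; NonZero)
open import Data.List.Membership.DecPropositional _≟_ using (_∈?_)
open import Data.Nat.Coprimality using (Coprime; coprime-Bézout; coprime⇒gcd≡1)
open import Data.Nat.Divisibility
open import Data.Nat.DivMod
open import Data.Nat.GCD using (gcd-greatest; c*gcd[m,n]≡gcd[cm,cn]; module Bézout)
open import Data.Nat.Induction using (<-wellFounded; <-rec)
open import Data.Nat.Primality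
open import Data.Nat.Primality.Factorisation using (factorise)
open import Data.Nat.Properties hiding (_≟_)
open import Data.Nat.Tactic.RingSolver using (solve-∀)
open import Data.Product using (_×_; _,_; ∃; ∃₂; proj₁; proj₂)
open import Data.Sum using (_⊎_; inj₁; inj₂; [_,_]′)
open import Data.Vec using ([]; _∷_; here; there)
open import Function using (_∘_; const; it; mk⇔; Equivalence)
open import Induction.WellFounded using (Acc; acc)
open import Relation.Binary.Definitions using (tri<; tri≈; tri>)
open import Relation.Binary.PropositionalEquality hiding ([_])
open import Relation.Nullary
open import Relation.Nullary.Decidable using (dec-true; dec-false)
open import Relation.Unary using (Decidable)
open import Defs

-- ℤ[X] acting on sequences

-- X acts on sequences by the left shift; two polynomials are equal iff they
-- act equally, so ring laws of ℤ[X] become laws of operators.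
infixr 7 _▷_
_▷_ : Poly → (ℕ → ℤ) → ℕ → ℤ
([]      ▷ g) n = 0ℤ
((a ∷ f) ▷ g) n = a ℤ.* g n ℤ.+ (f ▷ g) (suc n)

▷-cong : ∀ f {g h} → g ≗ h → f ▷ g ≗ f ▷ h
▷-cong []      e n = refl
▷-cong (a ∷ f) e n = cong₂ ℤ._+_ (cong (a ℤ.*_) (e n)) (▷-cong f e (suc n))

▷-zeroʳ : ∀ f {g} → (∀ n → g n ≡ 0ℤ) → ∀ n → (f ▷ g) n ≡ 0ℤ
▷-zeroʳ []      e n = refl
▷-zeroʳ (a ∷ f) e n = cong₂ ℤ._+_ (trans (cong (a ℤ.*_) (e n)) (ℤ.*-zeroʳ a)) (▷-zeroʳ f e (suc n))

▷-shift : ∀ f g n → (f ▷ (g ∘ suc)) n ≡ (f ▷ g) (suc n)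
▷-shift []      g n = refl
▷-shift (a ∷ f) g n = cong (λ z → a ℤ.* g (suc n) ℤ.+ z) (▷-shift f g (suc n))

▷-linearʳ : ∀ f a g h n → (f ▷ (λ k → a ℤ.* g k ℤ.+ h k)) n ≡ a ℤ.* (f ▷ g) n ℤ.+ (f ▷ h) n
▷-linearʳ []      a g h n = sym (trans (ℤ.+-identityʳ _) (ℤ.*-zeroʳ a))
▷-linearʳ (b ∷ f) a g h n = trans (cong (λ z → b ℤ.* (a ℤ.* g n ℤ.+ h n) ℤ.+ z) (▷-linearʳ f a g h (suc n)))
                                  (lem a b (g n) (h n) _ _)
  where
  lem : ∀ a b x y u v → b ℤ.* (a ℤ.* x ℤ.+ y) ℤ.+ (a ℤ.* u ℤ.+ v) ≡ a ℤ.* (b ℤ.* x ℤ.+ u) ℤ.+ (b ℤ.* y ℤ.+ v)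
  lem = ℤ.solve-∀

+-▷ : ∀ f h g n → ((f +ₚ h) ▷ g) n ≡ (f ▷ g) n ℤ.+ (h ▷ g) n
+-▷ []      h       g n = sym (ℤ.+-identityˡ _)
+-▷ (a ∷ f) []      g n = sym (ℤ.+-identityʳ _)
+-▷ (a ∷ f) (b ∷ h) g n = trans (cong (λ z → (a ℤ.+ b) ℤ.* g n ℤ.+ z) (+-▷ f h g (suc n))) (lem a b (g n) _ _)
  where
  lem : ∀ a b x u v → (a ℤ.+ b) ℤ.* x ℤ.+ (u ℤ.+ v) ≡ (a ℤ.* x ℤ.+ u) ℤ.+ (b ℤ.* x ℤ.+ v)
  lem = ℤ.solve-∀

·-▷ : ∀ c f g n → ((c ·ₚ f) ▷ g) n ≡ c ℤ.* (f ▷ g) n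
·-▷ c []      g n = sym (ℤ.*-zeroʳ c)
·-▷ c (a ∷ f) g n = trans (cong (λ z → c ℤ.* a ℤ.* g n ℤ.+ z) (·-▷ c f g (suc n))) (lem c a (g n) _)
  where
  lem : ∀ c a x u → c ℤ.* a ℤ.* x ℤ.+ c ℤ.* u ≡ c ℤ.* (a ℤ.* x ℤ.+ u)
  lem = ℤ.solve-∀

-- Multiplication becomes composition of operators, so associativity and distributivity of `*ₚ` need
-- no computation with convolution of coefficients.
*-▷ : ∀ f h g n → ((f *ₚ h) ▷ g) n ≡ (f ▷ (h ▷ g)) n
*-▷ []      h g n = refl
*-▷ (a ∷ f) h g n = begin
  ((a ·ₚ h +ₚ (0ℤ ∷ f *ₚ h)) ▷ g) n                                  ≡⟨ +-▷ (a ·ₚ h) _ g n ⟩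
  ((a ·ₚ h) ▷ g) n ℤ.+ (0ℤ ℤ.* g n ℤ.+ ((f *ₚ h) ▷ g) (suc n))       ≡⟨ cong₂ (λ x y → x ℤ.+ (y ℤ.+ ((f *ₚ h) ▷ g) (suc n))) (·-▷ a h g n) (ℤ.*-zeroˡ (g n)) ⟩
  a ℤ.* (h ▷ g) n ℤ.+ (0ℤ ℤ.+ ((f *ₚ h) ▷ g) (suc n))                ≡⟨ cong (λ z → a ℤ.* (h ▷ g) n ℤ.+ z) (trans (ℤ.+-identityˡ _) (*-▷ f h g (suc n))) ⟩
  a ℤ.* (h ▷ g) n ℤ.+ (f ▷ (h ▷ g)) (suc n)                          ∎
  where open ≡-Reasoning

-- Scalars and powers of the shift commute. Through `*-▷` this is the commutativity of `*ₚ`.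
▷-comm : ∀ f h g n → (f ▷ (h ▷ g)) n ≡ (h ▷ (f ▷ g)) n
▷-comm []      h g n = sym (▷-zeroʳ h (λ _ → refl) n)
▷-comm (a ∷ f) h g n = sym (begin
  (h ▷ ((a ∷ f) ▷ g)) n                                    ≡⟨ ▷-linearʳ h a g (λ k → (f ▷ g) (suc k)) n ⟩
  a ℤ.* (h ▷ g) n ℤ.+ (h ▷ ((f ▷ g) ∘ suc)) n              ≡⟨ cong (λ z → a ℤ.* (h ▷ g) n ℤ.+ z) (▷-shift h (f ▷ g) n) ⟩
  a ℤ.* (h ▷ g) n ℤ.+ (h ▷ (f ▷ g)) (suc n)                ≡⟨ cong (λ z → a ℤ.* (h ▷ g) n ℤ.+ z) (sym (▷-comm f h g (suc n))) ⟩
  a ℤ.* (h ▷ g) n ℤ.+ (f ▷ (h ▷ g)) (suc n)                ∎)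
  where open ≡-Reasoning

X^-▷ : ∀ k g n → ((X^ k) ▷ g) n ≡ g (n + k)
X^-▷ zero    g n = trans (ℤ.+-identityʳ _) (trans (ℤ.*-identityˡ _) (cong g (sym (+-identityʳ n))))
X^-▷ (suc k) g n = trans (cong₂ ℤ._+_ (ℤ.*-zeroˡ (g n)) (X^-▷ k g (suc n)))
                         (trans (ℤ.+-identityˡ _) (cong g (sym (+-suc n k))))

-- Equality of operators and the ring ℤ[X]

infix 4 _≋_
record _≋_ (f h : Poly) : Set where
  constructor mk≋
  field ▷-≡ : ∀ g n → (f ▷ g) n ≡ (h ▷ g) n
open _≋_

δ : ℕ → ℕ → ℤ
δ zero    zero    = 1ℤ
δ zero    (suc n) = 0ℤ
δ (suc k) zero    = 0ℤ
δ (suc k) (suc n) = δ k n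

▷-δ-zero : ∀ f n → (f ▷ δ zero) (suc n) ≡ 0ℤ
▷-δ-zero []      n = refl
▷-δ-zero (a ∷ f) n = cong₂ ℤ._+_ (ℤ.*-zeroʳ a) (▷-δ-zero f (suc n))

-- Makes the action faithful: every coefficient is a value of the operator on a test sequence.
coeff≡▷δ : ∀ f k → coeff f k ≡ (f ▷ δ k) 0
coeff≡▷δ []      k       = refl
coeff≡▷δ (a ∷ f) zero    = sym (trans (cong₂ ℤ._+_ (ℤ.*-identityʳ a) (▷-δ-zero f 0)) (ℤ.+-identityʳ a))
coeff≡▷δ (a ∷ f) (suc k) = sym (trans (cong₂ ℤ._+_ (ℤ.*-zeroʳ a) (sym (▷-shift f (δ (suc k)) 0)))
                                      (trans (ℤ.+-identityˡ _) (sym (coeff≡▷δ f k))))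

▷-≈0 : ∀ f g n → (∀ k → coeff f k ≡ 0ℤ) → (f ▷ g) n ≡ 0ℤ
▷-≈0 []      g n e = refl
▷-≈0 (a ∷ f) g n e = cong₂ ℤ._+_ (trans (cong (ℤ._* g n) (e 0)) (ℤ.*-zeroˡ (g n))) (▷-≈0 f g (suc n) (e ∘ suc))

≈⇒≋ : ∀ {f h} → f ≈ₚ h → f ≋ h
≈⇒≋ {f} {h} e = mk≋ (go f h e)
  where
  go : ∀ f h → f ≈ₚ h → ∀ g n → (f ▷ g) n ≡ (h ▷ g) n
  go []      h       e g n = sym (▷-≈0 h g n (sym ∘ e))
  go (a ∷ f) []      e g n = ▷-≈0 (a ∷ f) g n e
  go (a ∷ f) (b ∷ h) e g n = cong₂ ℤ._+_ (cong (ℤ._* g n) (e 0)) (go f h (e ∘ suc) g (suc n))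

≋⇒≈ : ∀ {f h} → f ≋ h → f ≈ₚ h
≋⇒≈ {f} {h} e k = trans (coeff≡▷δ f k) (trans (▷-≡ e (δ k) 0) (sym (coeff≡▷δ h k)))

polyRing : CommutativeRing _ _
polyRing = record
  { Carrier = Poly ; _≈_ = _≋_ ; _+_ = _+ₚ_ ; _*_ = _*ₚ_ ; -_ = -1ℤ ·ₚ_ ; 0# = [] ; 1# = 1ₚ
  ; isCommutativeRing = record
    { isRing = record
      { +-isAbelianGroup = record
        { isGroup = record
          { isMonoid = record
            { isSemigroup = record
              { isMagma = record
                { isEquivalence = record
                  { refl = mk≋ λ _ _ → refl
                  ; sym = λ e → mk≋ λ g n → sym (▷-≡ e g n)
                  ; trans = λ e e′ → mk≋ λ g n → trans (▷-≡ e g n) (▷-≡ e′ g n) }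
                ; ∙-cong = λ {f} {f′} {h} {h′} e e′ → mk≋ λ g n →
                    trans (+-▷ f h g n) (trans (cong₂ ℤ._+_ (▷-≡ e g n) (▷-≡ e′ g n)) (sym (+-▷ f′ h′ g n))) }
              ; assoc = λ f h k → mk≋ λ g n → trans (+-▷ (f +ₚ h) k g n)
                  (trans (cong (ℤ._+ (k ▷ g) n) (+-▷ f h g n)) (trans (ℤ.+-assoc ((f ▷ g) n) _ _)
                  (sym (trans (+-▷ f (h +ₚ k) g n) (cong (λ z → (f ▷ g) n ℤ.+ z) (+-▷ h k g n)))))) }
            ; identity = (λ f → mk≋ λ g n → refl)
                       , (λ f → mk≋ λ g n → trans (+-▷ f [] g n) (ℤ.+-identityʳ _)) }
          ; inverse = (λ f → mk≋ λ g n → trans (+-▷ (-1ℤ ·ₚ f) f g n) (trans (cong (ℤ._+ (f ▷ g) n) (·-▷ -1ℤ f g n)) (neg ((f ▷ g) n))))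
                    , (λ f → mk≋ λ g n → trans (+-▷ f (-1ℤ ·ₚ f) g n) (trans (cong (λ z → (f ▷ g) n ℤ.+ z) (·-▷ -1ℤ f g n)) (neg′ ((f ▷ g) n))))
          ; ⁻¹-cong = λ {f} {h} e → mk≋ λ g n → trans (·-▷ -1ℤ f g n) (trans (cong (-1ℤ ℤ.*_) (▷-≡ e g n)) (sym (·-▷ -1ℤ h g n))) }
        ; comm = λ f h → mk≋ λ g n → trans (+-▷ f h g n) (trans (ℤ.+-comm ((f ▷ g) n) _) (sym (+-▷ h f g n))) }
      ; *-cong = λ {f} {f′} {h} {h′} e e′ → mk≋ λ g n → trans (*-▷ f h g n)
          (trans (▷-≡ e (h ▷ g) n) (trans (▷-cong f′ (▷-≡ e′ g) n) (sym (*-▷ f′ h′ g n))))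
      ; *-assoc = λ f h k → mk≋ λ g n → trans (*-▷ (f *ₚ h) k g n) (trans (*-▷ f h (k ▷ g) n)
          (sym (trans (*-▷ f (h *ₚ k) g n) (▷-cong f (*-▷ h k g) n))))
      ; *-identity = (λ f → mk≋ λ g n → trans (*-▷ 1ₚ f g n) (one▷ (f ▷ g) n))
                   , (λ f → mk≋ λ g n → trans (*-▷ f 1ₚ g n) (▷-cong f (one▷ g) n))
      ; distrib = (λ f h k → mk≋ λ g n → trans (*-▷ f (h +ₚ k) g n)
                    (trans (▷-cong f (+-▷ h k g) n) (trans (▷-+ʳ f (h ▷ g) (k ▷ g) n)
                    (sym (trans (+-▷ (f *ₚ h) (f *ₚ k) g n) (cong₂ ℤ._+_ (*-▷ f h g n) (*-▷ f k g n)))))))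
                , (λ f h k → mk≋ λ g n → trans (*-▷ (h +ₚ k) f g n) (trans (+-▷ h k (f ▷ g) n)
                    (sym (trans (+-▷ (h *ₚ f) (k *ₚ f) g n) (cong₂ ℤ._+_ (*-▷ h f g n) (*-▷ k f g n))))))
      }
    ; *-comm = λ f h → mk≋ λ g n → trans (*-▷ f h g n) (trans (▷-comm f h g n) (sym (*-▷ h f g n)))
    }
  }
  where
  neg : ∀ x → -1ℤ ℤ.* x ℤ.+ x ≡ 0ℤ
  neg = ℤ.solve-∀
  neg′ : ∀ x → x ℤ.+ -1ℤ ℤ.* x ≡ 0ℤ
  neg′ = ℤ.solve-∀
  one▷ : ∀ g n → (1ₚ ▷ g) n ≡ g n
  one▷ g n = trans (ℤ.+-identityʳ _) (ℤ.*-identityˡ (g n))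
  ▷-+ʳ : ∀ f g h n → (f ▷ (λ k → g k ℤ.+ h k)) n ≡ (f ▷ g) n ℤ.+ (f ▷ h) n
  ▷-+ʳ f g h n = trans (▷-cong f (λ k → cong (ℤ._+ h k) (sym (ℤ.*-identityˡ (g k)))) n)
    (trans (▷-linearʳ f 1ℤ g h n) (cong (ℤ._+ (f ▷ h) n) (ℤ.*-identityˡ ((f ▷ g) n))))

-- Monic polynomials and long division

module R = CommutativeRing polyRing

coeff-+ : ∀ f h k → coeff (f +ₚ h) k ≡ coeff f k ℤ.+ coeff h k
coeff-+ []      h       k       = sym (ℤ.+-identityˡ _)
coeff-+ (a ∷ f) []      k       = sym (ℤ.+-identityʳ _)
coeff-+ (a ∷ f) (b ∷ h) zero    = refl
coeff-+ (a ∷ f) (b ∷ h) (suc k) = coeff-+ f h k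

coeff-· : ∀ c f k → coeff (c ·ₚ f) k ≡ c ℤ.* coeff f k
coeff-· c []      k       = sym (ℤ.*-zeroʳ c)
coeff-· c (a ∷ f) zero    = refl
coeff-· c (a ∷ f) (suc k) = coeff-· c f k

coeff-∷* : ∀ a f g k → coeff ((a ∷ f) *ₚ g) k ≡ a ℤ.* coeff g k ℤ.+ coeff (0ℤ ∷ f *ₚ g) k
coeff-∷* a f g k = trans (coeff-+ (a ·ₚ g) _ k) (cong (ℤ._+ coeff (0ℤ ∷ f *ₚ g) k) (coeff-· a g k))

coeff-- : ∀ f h k → coeff (f -ₚ h) k ≡ coeff f k ℤ.- coeff h k
coeff-- f h k = trans (coeff-+ f (-1ℤ ·ₚ h) k) (cong (λ z → coeff f k ℤ.+ z) (trans (coeff-· -1ℤ h k) (ℤ.-1*i≡-i _)))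

-- Degree less than `d`, phrased by vanishing coefficients so that trailing zeros do not matter and
-- the zero polynomial qualifies for every `d`.
_≺_ : Poly → ℕ → Set
f ≺ d = ∀ k → d ≤ k → coeff f k ≡ 0ℤ

Monic : ℕ → Poly → Set
Monic d f = coeff f d ≡ 1ℤ × f ≺ suc d

monic-resp : ∀ {d f h} → f ≋ h → Monic d f → Monic d h
monic-resp {d} e (l , z) = trans (sym (≋⇒≈ e d)) l , λ k d<k → trans (sym (≋⇒≈ e k)) (z k d<k)

dropTrailingZeros-zero : ∀ f → f ≺ 0 → dropTrailingZeros f ≡ []
dropTrailingZeros-zero []      z = refl
dropTrailingZeros-zero (a ∷ f) z
  rewrite dropTrailingZeros-zero f (λ k _ → z (suc k) z≤n) | z 0 z≤n = refl

length-dropTrailingZeros : ∀ d f → Monic d f → length (dropTrailingZeros f) ≡ suc d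
length-dropTrailingZeros d       []      (() , z)
length-dropTrailingZeros zero    (a ∷ f) (refl , z)
  rewrite dropTrailingZeros-zero f (λ k _ → z (suc k) (s≤s z≤n)) = refl
length-dropTrailingZeros (suc d) (a ∷ f) (l , z)
  with dropTrailingZeros f | length-dropTrailingZeros d f (l , λ k d<k → z (suc k) (s≤s d<k))
... | b ∷ p | e = cong suc e

degree-monic : ∀ {d f} → Monic d f → degree f ≡ d
degree-monic {d} {f} mon = cong pred (length-dropTrailingZeros d f mon)

monic-* : ∀ {d e} f g → Monic d f → Monic e g → Monic (d + e) (f *ₚ g)
monic-* {d} {e} [] g (() , _)
monic-* {zero} {e} (a ∷ f) g (refl , z) mg = monic-resp eq mg
  where
  eq : g ≋ ((1ℤ ∷ f) *ₚ g)
  eq = R.trans (R.sym (R.*-identityˡ g)) (R.*-congʳ {x = g} (≈⇒≋ {1ₚ} {1ℤ ∷ f} λ { zero → refl ; (suc k) → sym (z (suc k) (s≤s z≤n)) }))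
monic-* {suc d} {e} (a ∷ f) g (l , z) mg@(lg , zg) =
  let (li , zi) = monic-* {d} {e} f g (l , λ k d<k → z (suc k) (s≤s d<k)) mg
      zero* = λ k (e<k : e < k) → trans (cong (a ℤ.*_) (zg k e<k)) (ℤ.*-zeroʳ a)
  in trans (coeff-∷* a f g _) (trans (cong (ℤ._+ _) (zero* (suc (d + e)) (s≤s (m≤n+m e d)))) (trans (ℤ.+-identityˡ _) li))
   , λ { (suc k) (s≤s de<k) → trans (coeff-∷* a f g _)
          (cong₂ ℤ._+_ (zero* (suc k) (≤-trans (s≤s (m≤n+m e (suc d))) (s≤s de<k))) (zi k de<k)) }

-- Multiplication by a monic polynomial of degree `d` raises the degree of a nonzero polynomial by
-- `d`. Uniqueness of quotients and cancellation rest on this.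
low-degree⇒zero : ∀ {d} f g → Monic d g → (f *ₚ g) ≺ d → f ≋ []
low-degree⇒zero {d} []      g mg z = R.refl {[]}
low-degree⇒zero {d} (a ∷ f) g mg@(lg , zg) z = ≈⇒≋ λ { zero → a≡0 ; (suc k) → ≋⇒≈ f≋0 k }
  where
  f≋0 : f ≋ []
  f≋0 = low-degree⇒zero f g mg λ k d≤k → begin
    coeff (f *ₚ g) k                                          ≡⟨ ℤ.+-identityˡ _ ⟨
    0ℤ ℤ.+ coeff (f *ₚ g) k                                   ≡⟨ cong (ℤ._+ _) (ℤ.*-zeroʳ a) ⟨
    a ℤ.* 0ℤ ℤ.+ coeff (f *ₚ g) k                             ≡⟨ cong (λ z → a ℤ.* z ℤ.+ coeff (f *ₚ g) k) (zg (suc k) (s≤s d≤k)) ⟨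
    a ℤ.* coeff g (suc k) ℤ.+ coeff (f *ₚ g) k                ≡⟨ coeff-∷* a f g (suc k) ⟨
    coeff ((a ∷ f) *ₚ g) (suc k)                              ≡⟨ z (suc k) (m≤n⇒m≤1+n d≤k) ⟩
    0ℤ                                                        ∎
    where open ≡-Reasoning
  f*g≡0 : ∀ k → coeff (0ℤ ∷ f *ₚ g) k ≡ 0ℤ
  f*g≡0 zero    = refl
  f*g≡0 (suc k) = ≋⇒≈ (R.trans (R.*-congʳ {x = g} f≋0) (R.zeroˡ g)) k
  a≡0 : a ≡ 0ℤ
  a≡0 = begin
    a                                                ≡⟨ ℤ.*-identityʳ a ⟨
    a ℤ.* 1ℤ                                         ≡⟨ cong (a ℤ.*_) lg ⟨
    a ℤ.* coeff g d                                  ≡⟨ ℤ.+-identityʳ _ ⟨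
    a ℤ.* coeff g d ℤ.+ 0ℤ                           ≡⟨ cong (λ z → a ℤ.* coeff g d ℤ.+ z) (f*g≡0 d) ⟨
    a ℤ.* coeff g d ℤ.+ coeff (0ℤ ∷ f *ₚ g) d        ≡⟨ coeff-∷* a f g d ⟨
    coeff ((a ∷ f) *ₚ g) d                           ≡⟨ z d ≤-refl ⟩
    0ℤ                                               ∎
    where open ≡-Reasoning

x-y≋0⇒x≋y : ∀ {f h} → f +ₚ -1ℤ ·ₚ h ≋ [] → f ≋ h
x-y≋0⇒x≋y {f} {h} e = x∙y⁻¹≈ε⇒x≈y f h e
  where open import Algebra.Properties.Group R.+-group

monic-cancelʳ : ∀ {d} f h g → Monic d g → f *ₚ g ≋ h *ₚ g → f ≋ h
monic-cancelʳ {d} f h g mg e = x-y≋0⇒x≋y (low-degree⇒zero _ g mg λ k _ → ≋⇒≈ lem k)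
  where
  lem : (f +ₚ -1ℤ ·ₚ h) *ₚ g ≋ []
  lem = R.trans (R.distribʳ g f (R.- h)) (R.trans (R.+-congˡ {f *ₚ g} (R.sym (-‿distribˡ-* h g)))
        (R.trans (R.+-congʳ {R.- (h *ₚ g)} e) (R.-‿inverseʳ (h *ₚ g))))
    where open import Algebra.Properties.Ring R.ring using (-‿distribˡ-*)

-- Serves for a product of cyclotomic polynomials that is known only through an equation, its degree
-- never being computed.
monic-quotient : ∀ {d N} f g → Monic d g → Monic N (f *ₚ g) → ∃ λ e → Monic e f
monic-quotient [] g mg (() , _)
monic-quotient {d} {N} (a ∷ f) g mg@(lg , zg) (lN , zN) with d ℕ.<? N
-- Above degree `d` the constant term `a` does not contribute, so the tail `f` times `g` is monic of
-- degree `N′`.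
... | yes (s≤s {n = N′} d≤N′) =
  let (e , l , z) = monic-quotient {d} {N′} f g mg
        ( trans (sym (drop N′ d≤N′)) lN
        , λ k N′<k → trans (sym (drop k (≤-trans d≤N′ (<⇒≤ N′<k)))) (zN (suc k) (s≤s N′<k)))
  in suc e , l , λ { (suc k) (s≤s e<k) → z k e<k }
  where
  drop : ∀ k → d ≤ k → coeff ((a ∷ f) *ₚ g) (suc k) ≡ coeff (f *ₚ g) k
  drop k d≤k = trans (coeff-∷* a f g (suc k))
    (trans (cong (ℤ._+ coeff (f *ₚ g) k) (trans (cong (a ℤ.*_) (zg (suc k) (s≤s d≤k))) (ℤ.*-zeroʳ a))) (ℤ.+-identityˡ _))
-- The product has degree at most `d`, so the tail vanishes and the quotient is the constant `a`. If
-- `N` were below `d`, then `a`, being the coefficient at `d`, would be 0, and so would the leading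
-- coefficient at `N`.
... | no d≮N = 0 , a≡1 , λ { (suc k) _ → ≋⇒≈ f≋0 k }
  where
  N≤d = ≮⇒≥ d≮N
  f≋0 : f ≋ []
  f≋0 = low-degree⇒zero f g mg λ k d≤k → trans
    (sym (trans (coeff-∷* a f g (suc k))
      (trans (cong (ℤ._+ coeff (f *ₚ g) k) (trans (cong (a ℤ.*_) (zg (suc k) (s≤s d≤k))) (ℤ.*-zeroʳ a))) (ℤ.+-identityˡ _))))
    (zN (suc k) (s≤s (≤-trans N≤d d≤k)))
  f*g≡0 : ∀ k → coeff (0ℤ ∷ f *ₚ g) k ≡ 0ℤ
  f*g≡0 zero    = refl
  f*g≡0 (suc k) = ≋⇒≈ (R.trans (R.*-congʳ {x = g} f≋0) (R.zeroˡ g)) k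
  top : ∀ k → coeff ((a ∷ f) *ₚ g) k ≡ a ℤ.* coeff g k
  top k = trans (coeff-∷* a f g k) (trans (cong (λ z → a ℤ.* coeff g k ℤ.+ z) (f*g≡0 k)) (ℤ.+-identityʳ _))
  a≡top : coeff ((a ∷ f) *ₚ g) d ≡ a
  a≡top = trans (top d) (trans (cong (a ℤ.*_) lg) (ℤ.*-identityʳ a))
  a≡1 : a ≡ 1ℤ
  a≡1 with m≤n⇒m<n∨m≡n N≤d
  ... | inj₂ refl = trans (sym a≡top) lN
  ... | inj₁ N<d with () ← trans (sym lN) (trans (top N)
           (cong (ℤ._* coeff g N) (trans (sym a≡top) (zN d N<d))))

quotRem-spec : ∀ {d} f g → Monic d g →
               let (q , r) = quotRem f g in (q *ₚ g +ₚ r ≋ f) × (r ≺ d)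
quotRem-spec []      g mg = R.refl {[]} , λ _ _ → refl
quotRem-spec {d} (a ∷ f) g mg@(lg , zg) with quotRem f g | quotRem-spec f g mg
... | (q , r) | (eq , r≺d) rewrite degree-monic {d} {g} mg = mk≋ eq′ , z
  where
  c : ℤ
  c = coeff (a ∷ r) d
  eq′ : ∀ s n → (((c ∷ q) *ₚ g +ₚ ((a ∷ r) -ₚ c ·ₚ g)) ▷ s) n ≡ ((a ∷ f) ▷ s) n
  eq′ s n = begin
    (((c ∷ q) *ₚ g +ₚ ((a ∷ r) -ₚ c ·ₚ g)) ▷ s) n
      ≡⟨ +-▷ ((c ∷ q) *ₚ g) _ s n ⟩
    (((c ∷ q) *ₚ g) ▷ s) n ℤ.+ (((a ∷ r) -ₚ c ·ₚ g) ▷ s) n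
      ≡⟨ cong₂ ℤ._+_ (*-▷ (c ∷ q) g s n)
           (trans (+-▷ (a ∷ r) (-1ℤ ·ₚ c ·ₚ g) s n) (cong (λ z → ((a ∷ r) ▷ s) n ℤ.+ z) (trans (·-▷ -1ℤ (c ·ₚ g) s n) (cong (-1ℤ ℤ.*_) (·-▷ c g s n))))) ⟩
    c ℤ.* G ℤ.+ (q ▷ (g ▷ s)) (suc n) ℤ.+ (a ℤ.* s n ℤ.+ (r ▷ s) (suc n) ℤ.+ -1ℤ ℤ.* (c ℤ.* G))
      ≡⟨ lem c G ((q ▷ (g ▷ s)) (suc n)) (a ℤ.* s n) ((r ▷ s) (suc n)) ⟩
    a ℤ.* s n ℤ.+ ((q ▷ (g ▷ s)) (suc n) ℤ.+ (r ▷ s) (suc n))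
      ≡⟨ cong (λ z → a ℤ.* s n ℤ.+ (z ℤ.+ (r ▷ s) (suc n))) (*-▷ q g s (suc n)) ⟨
    a ℤ.* s n ℤ.+ (((q *ₚ g) ▷ s) (suc n) ℤ.+ (r ▷ s) (suc n))
      ≡⟨ cong (λ z → a ℤ.* s n ℤ.+ z) (+-▷ (q *ₚ g) r s (suc n)) ⟨
    a ℤ.* s n ℤ.+ ((q *ₚ g +ₚ r) ▷ s) (suc n)
      ≡⟨ cong (λ z → a ℤ.* s n ℤ.+ z) (▷-≡ eq s (suc n)) ⟩
    ((a ∷ f) ▷ s) n ∎
    where
    open ≡-Reasoning
    G = (g ▷ s) n
    lem : ∀ c G x y z → c ℤ.* G ℤ.+ x ℤ.+ (y ℤ.+ z ℤ.+ -1ℤ ℤ.* (c ℤ.* G)) ≡ y ℤ.+ (x ℤ.+ z)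
    lem = ℤ.solve-∀
  z : ((a ∷ r) -ₚ c ·ₚ g) ≺ d
  z k d≤k with m≤n⇒m<n∨m≡n d≤k
  ... | inj₂ refl = trans (coeff-- (a ∷ r) (c ·ₚ g) d) (trans (cong (λ z → c ℤ.- z) (trans (coeff-· c g d) (trans (cong (c ℤ.*_) lg) (ℤ.*-identityʳ c)))) (ℤ.+-inverseʳ c))
  ... | inj₁ d<k@(s≤s {n = k′} d≤k′) = trans (coeff-- (a ∷ r) (c ·ₚ g) k)
          (cong₂ ℤ._-_ (r≺d k′ d≤k′) (trans (coeff-· c g k) (trans (cong (c ℤ.*_) (zg k d<k)) (ℤ.*-zeroʳ c))))

-- The difference of `h` and the computed quotient, multiplied by `g`, equals the remainder, whose
-- degree is below `d`; hence the difference is 0.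
/-exact : ∀ {d} h g f → Monic d g → h *ₚ g ≋ f → f /ₚ g ≋ h
/-exact {d} h g f mg e with quotRem f g | quotRem-spec f g mg
... | (q , r) | (eq , r≺d) = R.sym (x-y≋0⇒x≋y (low-degree⇒zero _ g mg λ k d≤k → trans (≋⇒≈ lem k) (r≺d k d≤k)))
  where
  open import Algebra.Properties.Ring R.ring using (-‿distribˡ-*)
  open import Relation.Binary.Reasoning.Setoid R.setoid
  lem : (h +ₚ -1ℤ ·ₚ q) *ₚ g ≋ r
  lem = begin
    (h +ₚ -1ℤ ·ₚ q) *ₚ g                       ≈⟨ R.distribʳ g h (R.- q) ⟩
    h *ₚ g +ₚ (R.- q) *ₚ g                     ≈⟨ R.+-cong (R.trans e (R.sym eq)) (R.sym (-‿distribˡ-* q g)) ⟩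
    (q *ₚ g +ₚ r) +ₚ R.- (q *ₚ g)              ≈⟨ R.+-congʳ {R.- (q *ₚ g)} (R.+-comm (q *ₚ g) r) ⟩
    (r +ₚ q *ₚ g) +ₚ R.- (q *ₚ g)              ≈⟨ R.+-assoc r (q *ₚ g) _ ⟩
    r +ₚ (q *ₚ g +ₚ R.- (q *ₚ g))              ≈⟨ R.+-congˡ {r} (R.-‿inverseʳ (q *ₚ g)) ⟩
    r +ₚ []                                    ≈⟨ R.+-identityʳ r ⟩
    r                                          ∎

-- The polynomials Xⁿ - 1

E : ℕ → Poly
E n = X^ n -ₚ 1ₚ

E-▷ : ∀ n g k → (E n ▷ g) k ≡ g (k + n) ℤ.- g k
E-▷ n g k = trans (+-▷ (X^ n) (-1ℤ ·ₚ 1ₚ) g k) (cong₂ ℤ._+_ (X^-▷ n g k) (lem (g k)))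
  where
  lem : ∀ x → -1ℤ ℤ.* 1ℤ ℤ.* x ℤ.+ 0ℤ ≡ ℤ.- x
  lem = ℤ.solve-∀

E-+ : ∀ m n → (X^ m) *ₚ E n +ₚ E m ≋ E (m + n)
E-+ m n = mk≋ λ g k → trans (+-▷ ((X^ m) *ₚ E n) (E m) g k) (trans
  (cong₂ ℤ._+_ (trans (*-▷ (X^ m) (E n) g k) (trans (X^-▷ m (E n ▷ g) k) (E-▷ n g (k + m)))) (E-▷ m g k))
  (trans (lem (g (k + m + n)) (g (k + m)) (g k)) (trans (cong (λ z → g z ℤ.- g k) (+-assoc k m n)) (sym (E-▷ (m + n) g k)))))
  where
  lem : ∀ x y z → (x ℤ.- y) ℤ.+ (y ℤ.- z) ≡ x ℤ.- z
  lem = ℤ.solve-∀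

E-0 : E 0 ≋ []
E-0 = mk≋ λ g n → trans (E-▷ 0 g n) (trans (cong (λ z → g z ℤ.- g n) (+-identityʳ n)) (ℤ.+-inverseʳ (g n)))

X^-monic : ∀ n → Monic n (X^ n)
X^-monic zero    = refl , λ { (suc k) _ → refl }
X^-monic (suc n) = let (l , z) = X^-monic n in l , λ { (suc k) (s≤s n<k) → z k n<k }

E-monic : ∀ n .{{_ : NonZero n}} → Monic n (E n)
E-monic (suc n) = let (l , z) = X^-monic (suc n) in
  trans (coeff-- (X^ (suc n)) 1ₚ (suc n)) (trans (ℤ.+-identityʳ _) l)
  , λ { (suc k) n<k → trans (coeff-- (X^ (suc n)) 1ₚ (suc k)) (trans (ℤ.+-identityʳ _) (z (suc k) n<k)) }

-- The geometric sum 1 + X^k + ... + X^((r-1)k), built by Horner's rule; it is the quotient of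
-- X^(rk) - 1 by X^k - 1.
repunit : ℕ → ℕ → Poly
repunit zero    k = []
repunit (suc r) k = (X^ k) *ₚ repunit r k +ₚ 1ₚ

repunit-*-E : ∀ r k → repunit r k *ₚ E k ≋ E (r * k)
repunit-*-E zero    k = R.sym E-0
repunit-*-E (suc r) k = begin
  ((X^ k) *ₚ repunit r k +ₚ 1ₚ) *ₚ E k        ≈⟨ lem (X^ k) (repunit r k) (E k) ⟩
  (X^ k) *ₚ (repunit r k *ₚ E k) +ₚ E k       ≈⟨ R.+-congʳ {E k} (R.*-congˡ {X^ k} (repunit-*-E r k)) ⟩
  (X^ k) *ₚ E (r * k) +ₚ E k                  ≈⟨ E-+ k (r * k) ⟩
  E (k + r * k)                               ∎
  where
  open import Relation.Binary.Reasoning.Setoid R.setoid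
  lem : ∀ x c e → (x R.* c R.+ R.1#) R.* e R.≈ x R.* (c R.* e) R.+ e
  lem x c e = R.trans (R.distribʳ e (x R.* c) R.1#) (R.+-cong (R.*-assoc x c e) (R.*-identityˡ e))

eval-▷ : ∀ f n → eval f 1ℤ ≡ (f ▷ const 1ℤ) n
eval-▷ []      n = refl
eval-▷ (a ∷ f) n = cong₂ ℤ._+_ (sym (ℤ.*-identityʳ a)) (trans (ℤ.*-identityˡ _) (eval-▷ f (suc n)))

eval-≋ : ∀ {f h} → f ≋ h → eval f 1ℤ ≡ eval h 1ℤ
eval-≋ {f} {h} e = trans (eval-▷ f 0) (trans (▷-≡ e _ 0) (sym (eval-▷ h 0)))

eval-repunit : ∀ r k → eval (repunit r k) 1ℤ ≡ + r
eval-repunit r k = trans (eval-▷ (repunit r k) 0) (go r 0)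
  where
  go : ∀ r n → (repunit r k ▷ const 1ℤ) n ≡ + r
  go zero    n = refl
  go (suc r) n = trans (+-▷ ((X^ k) *ₚ repunit r k) 1ₚ _ n) (trans (cong (ℤ._+ 1ℤ)
    (trans (*-▷ (X^ k) (repunit r k) _ n) (trans (X^-▷ k _ n) (go r (n + k))))) (cong +_ (+-comm r 1)))

-- A Bézout relation between exponents lifts to polynomials: since xpk = k + yqk, subtracting X^k
-- (X^(yqk) - 1) from X^(xpk) - 1 leaves X^k - 1.
E-combination : ∀ k p q x y → 1 + y * q ≡ x * p →
  repunit x (p * k) *ₚ E (p * k) +ₚ (R.- ((X^ k) *ₚ repunit y (q * k))) *ₚ E (q * k) ≋ E k
E-combination k p q x y eq = begin
  repunit x (p * k) *ₚ E (p * k) +ₚ (R.- ((X^ k) *ₚ repunit y (q * k))) *ₚ E (q * k)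
    ≈⟨ R.+-cong (repunit-*-E x (p * k)) (R.sym (-‿distribˡ-* ((X^ k) *ₚ repunit y (q * k)) (E (q * k)))) ⟩
  E (x * (p * k)) +ₚ R.- ((X^ k) *ₚ repunit y (q * k) *ₚ E (q * k))
    ≡⟨ cong (λ n → E n +ₚ R.- ((X^ k) *ₚ repunit y (q * k) *ₚ E (q * k))) exponents ⟩
  E (k + y * (q * k)) +ₚ R.- ((X^ k) *ₚ repunit y (q * k) *ₚ E (q * k))
    ≈⟨ R.+-cong (R.sym (E-+ k (y * (q * k)))) (R.-‿cong (R.trans (R.*-assoc (X^ k) _ _) (R.*-congˡ {X^ k} (repunit-*-E y (q * k))))) ⟩
  ((X^ k) *ₚ E (y * (q * k)) +ₚ E k) +ₚ R.- ((X^ k) *ₚ E (y * (q * k)))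
    ≈⟨ xyx⁻¹≈y ((X^ k) *ₚ E (y * (q * k))) (E k) ⟩
  E k ∎
  where
  open import Algebra.Properties.Ring R.ring using (-‿distribˡ-*)
  open import Relation.Binary.Reasoning.Setoid R.setoid
  open import Algebra.Properties.AbelianGroup R.+-abelianGroup using (xyx⁻¹≈y)
  exponents : x * (p * k) ≡ k + y * (q * k)
  exponents = trans (sym (*-assoc x p k)) (trans (cong (_* k) (sym eq)) (cong (λ z → k + z) (*-assoc y q k)))

-- The greatest common divisor of X^(pk) - 1 and X^(qk) - 1 is a combination of them over ℤ, not
-- only over ℚ. The two cases are the two signs of the Bézout identity.
E-Bézout : ∀ {p q} k → Coprime p q → ∃₂ λ u v → u *ₚ E (p * k) +ₚ v *ₚ E (q * k) ≋ E k
E-Bézout {p} {q} k cop with coprime-Bézout cop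
... | Bézout.+- x y eq = repunit x (p * k) , R.- ((X^ k) *ₚ repunit y (q * k)) , E-combination k p q x y eq
... | Bézout.-+ x y eq = R.- ((X^ k) *ₚ repunit x (p * k)) , repunit y (q * k) ,
  R.trans (R.+-comm ((R.- ((X^ k) *ₚ repunit x (p * k))) *ₚ E (p * k)) (repunit y (q * k) *ₚ E (q * k)))
          (E-combination k q p y x eq)

-- Cyclotomic polynomials of order pⁱqʲ

cyclotomic-irrelevant : ∀ n (a b : Acc _<_ n) → cyclotomic n a ≡ cyclotomic n b
cyclotomic-irrelevant n (acc rs) (acc rs′) = cong (λ l → (X^ n -ₚ 1ₚ) /ₚ ∏ₚ l)
  (map-cong (λ d → cyclotomic-irrelevant (toℕ d) (rs (toℕ<n d)) (rs′ (toℕ<n d))) (filter (λ d → toℕ d ∣? n) (allFin n)))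

Φ-unfold : ∀ n → Φ n ≡ E n /ₚ ∏ₚ (map (Φ ∘ toℕ) (filter (λ d → toℕ d ∣? n) (allFin n)))
Φ-unfold n = unfold (<-wellFounded n)
  where
  unfold : ∀ a → cyclotomic n a ≡ E n /ₚ ∏ₚ (map (Φ ∘ toℕ) (filter (λ d → toℕ d ∣? n) (allFin n)))
  unfold (acc rs) = cong (λ l → E n /ₚ ∏ₚ l)
    (map-cong (λ d → cyclotomic-irrelevant (toℕ d) (rs (toℕ<n d)) (<-wellFounded (toℕ d)))
              (filter (λ d → toℕ d ∣? n) (allFin n)))

∏< : ℕ → (ℕ → Poly) → Poly
∏< zero    h = 1ₚ
∏< (suc n) h = h 0 *ₚ ∏< n (h ∘ suc)

∏<-cong : ∀ n {h h′} → (∀ d → d < n → h d ≋ h′ d) → ∏< n h ≋ ∏< n h′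
∏<-cong zero    e = R.refl
∏<-cong (suc n) e = R.*-cong (e 0 (s≤s z≤n)) (∏<-cong n λ d d<n → e (suc d) (s≤s d<n))

∏<-* : ∀ n h h′ → ∏< n (λ d → h d *ₚ h′ d) ≋ ∏< n h *ₚ ∏< n h′
∏<-* zero    h h′ = R.sym (R.*-identityˡ 1ₚ)
∏<-* (suc n) h h′ = R.trans (R.*-congˡ {h 0 *ₚ h′ 0} (∏<-* n (h ∘ suc) (h′ ∘ suc)))
  (interchange (h 0) (h′ 0) (∏< n (h ∘ suc)) (∏< n (h′ ∘ suc)))
  where open import Algebra.Properties.CommutativeSemigroup R.*-commutativeSemigroup using (interchange)

∏<-suc : ∀ n h → ∏< (suc n) h ≋ ∏< n h *ₚ h n
∏<-suc zero    h = R.*-comm (h 0) 1ₚ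
∏<-suc (suc n) h = R.trans (R.*-congˡ {h 0} (∏<-suc n (h ∘ suc))) (R.sym (R.*-assoc (h 0) _ _))

∏<-extend : ∀ {m n} h → m ≤ n → (∀ d → m ≤ d → h d ≋ 1ₚ) → ∏< n h ≋ ∏< m h
∏<-extend {n = zero}  h z≤n  e = R.refl
∏<-extend {n = suc n} h m≤sn e with m≤n⇒m<n∨m≡n m≤sn
... | inj₂ refl      = R.refl
... | inj₁ (s≤s m≤n) = R.trans (∏<-suc n h) (R.trans (R.*-cong (∏<-extend h m≤n e) (e n m≤n)) (R.*-identityʳ _))

∏ₚ-filter : ∀ {A : Set} {P : A → Set} (P? : Decidable P) (f : A → Poly) xs →
            ∏ₚ (map f (filter P? xs)) ≋ ∏ₚ (map (λ x → if does (P? x) then f x else 1ₚ) xs)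
∏ₚ-filter P? f []       = R.refl
∏ₚ-filter P? f (x ∷ xs) with does (P? x)
... | true  = R.*-congˡ {f x} (∏ₚ-filter P? f xs)
... | false = R.trans (∏ₚ-filter P? f xs) (R.sym (R.*-identityˡ _))

∏ₚ-allFin : ∀ n h → ∏ₚ (map (h ∘ toℕ) (allFin n)) ≡ ∏< n h
∏ₚ-allFin n h = trans (cong ∏ₚ (map-tabulate {n = n} (λ i → i) (h ∘ toℕ))) (go n h)
  where
  go : ∀ n h → ∏ₚ (tabulate {n = n} (h ∘ toℕ)) ≡ ∏< n h
  go zero    h = refl
  go (suc n) h = cong (h 0 *ₚ_) (go n (h ∘ suc))

-- Non-divisors contribute the factor 1, so that divisor products for different `n` can be compared
-- factor by factor over one index range.
Φ∣ : ℕ → ℕ → Poly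
Φ∣ n d = if does (d ∣? n) then Φ d else 1ₚ

Φ∣-yes : ∀ {n d} → d ∣ n → Φ∣ n d ≡ Φ d
Φ∣-yes {n} {d} d∣n rewrite dec-true (d ∣? n) d∣n = refl

Φ∣-no : ∀ {n d} → ¬ d ∣ n → Φ∣ n d ≡ 1ₚ
Φ∣-no {n} {d} d∤n rewrite dec-false (d ∣? n) d∤n = refl

-- The identity Xⁿ - 1 = ∏ Φ_d over the divisors d of n. `Φ` is defined by a division whose
-- remainder is discarded, so the exactness of that division has to be proved; it is established
-- below for n = pⁱqʲ.
FactorsThrough : ℕ → Set
FactorsThrough n = ∏< (suc n) (Φ∣ n) ≋ E n

∏<-divisors : ∀ {k n} .{{_ : NonZero k}} → k < n → FactorsThrough k → ∏< n (Φ∣ k) ≋ E k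
∏<-divisors {k} k<n good = R.trans (∏<-extend (Φ∣ k) k<n λ d k<d → R.reflexive (Φ∣-no (>⇒∤ k<d))) good

-- To compute `Φ n` it suffices to exhibit the quotient `w`: division by the monic product over the
-- proper divisors is then exact, and the product identity continues to `n`.
Φ-exact : ∀ {n d} w → Monic d (∏< n (Φ∣ n)) → w *ₚ ∏< n (Φ∣ n) ≋ E n → Φ n ≋ w × FactorsThrough n
Φ-exact {n} {d} w mon e = Φ≋w , (begin
  ∏< (suc n) (Φ∣ n)            ≈⟨ ∏<-suc n (Φ∣ n) ⟩
  ∏< n (Φ∣ n) *ₚ Φ∣ n n        ≡⟨ cong (∏< n (Φ∣ n) *ₚ_) (Φ∣-yes {n} ∣-refl) ⟩
  ∏< n (Φ∣ n) *ₚ Φ n           ≈⟨ R.*-congˡ {∏< n (Φ∣ n)} Φ≋w ⟩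
  ∏< n (Φ∣ n) *ₚ w             ≈⟨ R.*-comm _ w ⟩
  w *ₚ ∏< n (Φ∣ n)             ≈⟨ e ⟩
  E n                          ∎)
  where
  open import Relation.Binary.Reasoning.Setoid R.setoid
  G : Poly
  G = ∏ₚ (map (Φ ∘ toℕ) (filter (λ d → toℕ d ∣? n) (allFin n)))
  G≋ : G ≋ ∏< n (Φ∣ n)
  G≋ = R.trans (∏ₚ-filter (λ d → toℕ d ∣? n) (Φ ∘ toℕ) (allFin n)) (R.reflexive (∏ₚ-allFin n (Φ∣ n)))
  Φ≋w : Φ n ≋ w
  Φ≋w = R.trans (R.reflexive (Φ-unfold n)) (/-exact w G (E n) (monic-resp (R.sym G≋) mon) (R.trans (R.*-congˡ {w} G≋) e))

-- The proper divisors of pk are exactly the divisors of k, so the product over them is X^k - 1.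
Φ-prime-step : ∀ p k .{{_ : NonZero k}} → k < p * k → (∀ {d} → d < p * k → d ∣ p * k → d ∣ k) →
               FactorsThrough k → Φ (p * k) ≋ repunit p k × FactorsThrough (p * k)
Φ-prime-step p k k<n proper good = Φ-exact (repunit p k) (monic-resp (R.sym G≋E) (E-monic k))
  (R.trans (R.*-congˡ {repunit p k} G≋E) (repunit-*-E p k))
  where
  same : ∀ d → d < p * k → Φ∣ (p * k) d ≋ Φ∣ k d
  same d d<n with d ∣? k
  ... | yes d∣k = R.reflexive (Φ∣-yes (∣n⇒∣m*n p d∣k))
  ... | no  d∤k = R.reflexive (Φ∣-no (d∤k ∘ proper d<n))
  G≋E : ∏< (p * k) (Φ∣ (p * k)) ≋ E k
  G≋E = R.trans (∏<-cong (p * k) same) (∏<-divisors k<n good)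

-- Inclusion-exclusion: a proper divisor of pqk divides pk or qk, and one that divides both divides
-- k. Hence the product `G` over the proper divisors satisfies G (X^k - 1) = (X^(pk) - 1)(X^(qk) -
-- 1).
Φ-two-primes-step : ∀ p q k .{{_ : NonZero p}} .{{_ : NonZero q}} .{{_ : NonZero k}} →
  Coprime p q → p * k < p * (q * k) → q * k < p * (q * k) →
  (∀ {d} → d < p * (q * k) → d ∣ p * (q * k) → (d ∣ p * k) ⊎ (d ∣ q * k)) →
  FactorsThrough k → FactorsThrough (p * k) → FactorsThrough (q * k) →
  Φ (p * (q * k)) *ₚ (E (p * k) *ₚ E (q * k)) ≋ E (p * (q * k)) *ₚ E k × FactorsThrough (p * (q * k))
Φ-two-primes-step p q k cop pk<n qk<n proper good-k good-pk good-qk =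
  let (Φ≋w , good) = Φ-exact w (proj₂ G-monic) w*G
  in R.trans (R.*-congʳ {E (p * k) *ₚ E (q * k)} Φ≋w) w*EE , good
  where
  open import Relation.Binary.Reasoning.Setoid R.setoid
  open import Algebra.Properties.CommutativeSemigroup R.*-commutativeSemigroup using (interchange)
  instance
    _ = m*n≢0 p k
    _ = m*n≢0 q k
  n = p * (q * k)
  G = ∏< n (Φ∣ n)
  k<n : k < n
  k<n = ≤-<-trans (m≤n*m k q) qk<n
  divides-both : ∀ {d} → d ∣ p * k → d ∣ q * k → d ∣ k
  divides-both {d} d∣pk d∣qk = subst (d ∣_)
    (trans (sym (c*gcd[m,n]≡gcd[cm,cn] k p q)) (trans (cong (k *_) (coprime⇒gcd≡1 cop)) (*-identityʳ k)))
    (gcd-greatest (subst (d ∣_) (*-comm p k) d∣pk) (subst (d ∣_) (*-comm q k) d∣qk))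
  inclusion-exclusion : ∀ d → d < n → Φ∣ n d *ₚ Φ∣ k d ≋ Φ∣ (p * k) d *ₚ Φ∣ (q * k) d
  inclusion-exclusion d d<n with d ∣? p * k | d ∣? q * k
  ... | yes d∣pk | yes d∣qk = R.reflexive (cong₂ _*ₚ_ (Φ∣-yes (∣n⇒∣m*n p d∣qk)) (Φ∣-yes (divides-both d∣pk d∣qk)))
  ... | yes d∣pk | no  d∤qk = R.reflexive (cong₂ _*ₚ_ (Φ∣-yes (∣-trans d∣pk pk∣n)) (Φ∣-no (d∤qk ∘ ∣n⇒∣m*n q)))
    where pk∣n = *-monoʳ-∣ p (n∣m*n q)
  ... | no  d∤pk | yes d∣qk = R.trans (R.reflexive (cong₂ _*ₚ_ (Φ∣-yes (∣n⇒∣m*n p d∣qk)) (Φ∣-no (d∤pk ∘ ∣n⇒∣m*n p)))) (R.*-comm (Φ d) 1ₚ)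
  ... | no  d∤pk | no  d∤qk = R.reflexive (cong₂ _*ₚ_ (Φ∣-no ([ d∤pk , d∤qk ]′ ∘ proper d<n)) (Φ∣-no (d∤pk ∘ ∣n⇒∣m*n p)))
  G*E : G *ₚ E k ≋ E (p * k) *ₚ E (q * k)
  G*E = begin
    G *ₚ E k                                           ≈⟨ R.*-congˡ {G} (∏<-divisors k<n good-k) ⟨
    G *ₚ ∏< n (Φ∣ k)                                   ≈⟨ ∏<-* n (Φ∣ n) (Φ∣ k) ⟨
    ∏< n (λ d → Φ∣ n d *ₚ Φ∣ k d)                      ≈⟨ ∏<-cong n inclusion-exclusion ⟩
    ∏< n (λ d → Φ∣ (p * k) d *ₚ Φ∣ (q * k) d)          ≈⟨ ∏<-* n (Φ∣ (p * k)) (Φ∣ (q * k)) ⟩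
    ∏< n (Φ∣ (p * k)) *ₚ ∏< n (Φ∣ (q * k))             ≈⟨ R.*-cong (∏<-divisors pk<n good-pk) (∏<-divisors qk<n good-qk) ⟩
    E (p * k) *ₚ E (q * k)                             ∎
  G-monic : ∃ λ d → Monic d G
  G-monic = monic-quotient G (E k) (E-monic k)
    (monic-resp (R.sym G*E) (monic-* (E (p * k)) (E (q * k)) (E-monic (p * k)) (E-monic (q * k))))
  u = proj₁ (E-Bézout k cop)
  v = proj₁ (proj₂ (E-Bézout k cop))
  -- Write `E k` as `u *ₚ E (p * k) +ₚ v *ₚ E (q * k)`, multiply by `E n`, and divide each term by
  -- `E (p * k) *ₚ E (q * k)`: the two quotients that arise are repunits.
  w = u *ₚ repunit p (q * k) +ₚ v *ₚ repunit q (p * k)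
  swap-factors : q * (p * k) ≡ n
  swap-factors = trans (sym (*-assoc q p k)) (trans (cong (_* k) (*-comm q p)) (*-assoc p q k))
  w*EE : w *ₚ (E (p * k) *ₚ E (q * k)) ≋ E n *ₚ E k
  w*EE = begin
    w *ₚ (E (p * k) *ₚ E (q * k))
      ≈⟨ R.distribʳ (E (p * k) *ₚ E (q * k)) (u *ₚ repunit p (q * k)) (v *ₚ repunit q (p * k)) ⟩
    u *ₚ repunit p (q * k) *ₚ (E (p * k) *ₚ E (q * k)) +ₚ v *ₚ repunit q (p * k) *ₚ (E (p * k) *ₚ E (q * k))
      ≈⟨ R.+-cong (interchange u _ _ _)
           (R.trans (R.*-congˡ {v *ₚ repunit q (p * k)} (R.*-comm (E (p * k)) (E (q * k)))) (interchange v _ _ _)) ⟩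
    u *ₚ E (p * k) *ₚ (repunit p (q * k) *ₚ E (q * k)) +ₚ v *ₚ E (q * k) *ₚ (repunit q (p * k) *ₚ E (p * k))
      ≈⟨ R.+-cong (R.*-congˡ {u *ₚ E (p * k)} (repunit-*-E p (q * k)))
           (R.*-congˡ {v *ₚ E (q * k)} (R.trans (repunit-*-E q (p * k)) (R.reflexive (cong E swap-factors)))) ⟩
    u *ₚ E (p * k) *ₚ E n +ₚ v *ₚ E (q * k) *ₚ E n
      ≈⟨ R.distribʳ (E n) (u *ₚ E (p * k)) (v *ₚ E (q * k)) ⟨
    (u *ₚ E (p * k) +ₚ v *ₚ E (q * k)) *ₚ E n
      ≈⟨ R.*-congʳ {E n} (proj₂ (proj₂ (E-Bézout k cop))) ⟩
    E k *ₚ E n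
      ≈⟨ R.*-comm (E k) (E n) ⟩
    E n *ₚ E k ∎
  w*G : w *ₚ G ≋ E n
  w*G = monic-cancelʳ (w *ₚ G) (E n) (E k) (E-monic k)
    (R.trans (R.*-assoc w G (E k)) (R.trans (R.*-congˡ {w} G*E) w*EE))

-- Prime divisors and proper divisors

prime-divisor : ∀ n .{{_ : NonZero n}} → n ≢ 1 → ∃ λ r → Prime r × r ∣ n
prime-divisor n n≢1 with factorise n
... | record { factors = []     ; isFactorisation = e } = ⊥-elim (n≢1 e)
... | record { factors = r ∷ rs ; isFactorisation = e ; factorsPrime = pr ∷ _ } =
  r , pr , subst (r ∣_) (sym e) (m∣m*n _)

prime∣^⇒≡ : ∀ {r p} i → Prime r → Prime p → r ∣ p ^ i → r ≡ p
prime∣^⇒≡ zero rp pp r∣1 = ⊥-elim (¬prime[1] (subst Prime (∣1⇒≡1 r∣1) rp))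
prime∣^⇒≡ {r} {p} (suc i) rp pp r∣ with euclidsLemma p (p ^ i) rp r∣
... | inj₂ r∣pⁱ = prime∣^⇒≡ i rp pp r∣pⁱ
... | inj₁ r∣p with prime⇒irreducible pp r∣p
...   | inj₁ refl = ⊥-elim (¬prime[1] rp)
...   | inj₂ r≡p  = r≡p

prime∤⇒coprime : ∀ {p n} → Prime p → ¬ p ∣ n → Coprime p n
prime∤⇒coprime pp p∤n (d∣p , d∣n) with prime⇒irreducible pp d∣p
... | inj₁ d≡1  = d≡1
... | inj₂ refl = ⊥-elim (p∤n d∣n)

-- Take for `r` a prime divisor of the cofactor n/d; then d still divides n/r. The quotient n/r is
-- quantified as any `k` with n = rk, so that callers can present it in their own form.
proper-divisor : ∀ {d n} .{{_ : NonZero n}} → d < n → d ∣ n →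
                 ∃ λ r → Prime r × r ∣ n × (∀ {k} → n ≡ r * k → d ∣ k)
proper-divisor {d} {n} d<n (divides e n≡e*d)
  with prime-divisor e {{m*n≢0⇒m≢0 e {{subst NonZero n≡e*d it}}}} (λ { refl → <-irrefl (sym (trans n≡e*d (+-identityʳ d))) d<n })
... | r , rp , divides f e≡f*r = r , rp , subst (r ∣_) (sym n≡e*d) (∣m⇒∣m*n d (divides f e≡f*r)) ,
  λ {k} n≡rk → divides f (sym (*-cancelˡ-≡ (f * d) k r {{prime⇒nonZero rp}} (begin
    r * (f * d)   ≡⟨ *-assoc r f d ⟨
    r * f * d     ≡⟨ cong (_* d) (*-comm r f) ⟩
    f * r * d     ≡⟨ cong (_* d) e≡f*r ⟨
    e * d         ≡⟨ n≡e*d ⟨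
    n             ≡⟨ n≡rk ⟩
    r * k         ∎)))
  where open ≡-Reasoning

k<p*k : ∀ {p} k .{{_ : NonZero k}} → Prime p → k < p * k
k<p*k {p} k pp = subst (_< p * k) (*-identityˡ k) (*-monoˡ-< k (ℕ.nonTrivial⇒n>1 p {{prime⇒nonTrivial pp}}))

-- The cyclotomic identities at 1, pⁱ and pⁱqʲ

factorsThrough-1 : FactorsThrough 1
factorsThrough-1 = proj₂ (Φ-exact {1} {0} (E 1) (monic-resp one (refl , λ { (suc k) _ → refl }))
                     (R.trans (R.*-congˡ {E 1} (R.sym one)) (R.*-identityʳ (E 1))))
  where
  one : 1ₚ ≋ ∏< 1 (Φ∣ 1)
  one = R.sym (R.*-identityˡ 1ₚ)

module _ {p} (pp : Prime p) where
  private instance _ = prime⇒nonZero pp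

  proper-divisor-power : ∀ i {d} → d < p * p ^ i → d ∣ p * p ^ i → d ∣ p ^ i
  proper-divisor-power i d<n d∣n with proper-divisor {{m^n≢0 p (suc i)}} d<n d∣n
  ... | r , rp , r∣n , d∣ with refl ← prime∣^⇒≡ (suc i) rp pp r∣n = d∣ refl

  factorsThrough-^ : ∀ i → FactorsThrough (p ^ i)
  Φ-prime-power : ∀ i → Φ (p ^ suc i) ≋ repunit p (p ^ i)

  factorsThrough-^ zero    = factorsThrough-1
  factorsThrough-^ (suc i) = proj₂ (Φ-prime-step p (p ^ i) {{m^n≢0 p i}} (k<p*k (p ^ i) {{m^n≢0 p i}} pp) (proper-divisor-power i) (factorsThrough-^ i))
  Φ-prime-power i = proj₁ (Φ-prime-step p (p ^ i) {{m^n≢0 p i}} (k<p*k (p ^ i) {{m^n≢0 p i}} pp) (proper-divisor-power i) (factorsThrough-^ i))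

  eval-Φ-prime-power : ∀ i → eval (Φ (p ^ suc i)) 1ℤ ≡ + p
  eval-Φ-prime-power i = trans (eval-≋ (Φ-prime-power i)) (eval-repunit p (p ^ i))

  Φ-prime-power-*-E : ∀ i → Φ (p ^ suc i) *ₚ E (p ^ i) ≋ E (p ^ suc i)
  Φ-prime-power-*-E i = R.trans (R.*-congʳ {E (p ^ i)} (Φ-prime-power i)) (repunit-*-E p (p ^ i))

module _ {p q} (pp : Prime p) (qp : Prime q) (p≢q : p ≢ q) where
  private instance
    _ = prime⇒nonZero pp
    _ = prime⇒nonZero qp

  p^i*q^j≢0 : ∀ i j → NonZero (p ^ i * q ^ j)
  p^i*q^j≢0 i j = m*n≢0 (p ^ i) (q ^ j) {{m^n≢0 p i}} {{m^n≢0 q j}}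

  q*-pᵢqⱼ : ∀ i j → p ^ i * (q * q ^ j) ≡ q * (p ^ i * q ^ j)
  q*-pᵢqⱼ i j = trans (sym (*-assoc (p ^ i) q _)) (trans (cong (_* q ^ j) (*-comm (p ^ i) q)) (*-assoc q (p ^ i) _))

  pq*-pᵢqⱼ : ∀ i j → p * p ^ i * (q * q ^ j) ≡ p * (q * (p ^ i * q ^ j))
  pq*-pᵢqⱼ i j = trans (*-assoc p (p ^ i) _) (cong (p *_) (q*-pᵢqⱼ i j))

  -- Induction on both exponents: the case (i+1, j+1) rests on (i, j), (i+1, j) and (i, j+1), and
  -- the border cases are prime powers.
  factorsThrough-^*^ : ∀ i j → FactorsThrough (p ^ i * q ^ j)

  private
    step : ∀ i j → let k = p ^ i * q ^ j in
           Φ (p * (q * k)) *ₚ (E (p * k) *ₚ E (q * k)) ≋ E (p * (q * k)) *ₚ E k × FactorsThrough (p * (q * k))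
    step i j = Φ-two-primes-step p q k (prime∤⇒coprime pp λ p∣q → p≢q (prime∣^⇒≡ 1 pp qp (subst (p ∣_) (sym (*-identityʳ q)) p∣q)))
      (*-monoʳ-< p (k<p*k k qp)) (k<p*k (q * k) {{m*n≢0 q k}} pp) proper
      (factorsThrough-^*^ i j)
      (subst FactorsThrough (*-assoc p (p ^ i) (q ^ j)) (factorsThrough-^*^ (suc i) j))
      (subst FactorsThrough (q*-pᵢqⱼ i j) (factorsThrough-^*^ i (suc j)))
      where
      k = p ^ i * q ^ j
      instance
        _ = p^i*q^j≢0 i j
      proper : ∀ {d} → d < p * (q * k) → d ∣ p * (q * k) → (d ∣ p * k) ⊎ (d ∣ q * k)
      proper {d} d<n d∣n with proper-divisor {{m*n≢0 p (q * k) {{it}} {{m*n≢0 q k}}}} d<n d∣n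
      ... | r , rp , r∣n , d∣ with euclidsLemma (p ^ suc i) (q ^ suc j) rp (subst (r ∣_) (sym (pq*-pᵢqⱼ i j)) r∣n)
      ...   | inj₁ r∣p^ with refl ← prime∣^⇒≡ (suc i) rp pp r∣p^ = inj₂ (d∣ refl)
      ...   | inj₂ r∣q^ with refl ← prime∣^⇒≡ (suc j) rp qp r∣q^ = inj₁ (d∣ (trans (sym (*-assoc p q k)) (trans (cong (_* k) (*-comm p q)) (*-assoc q p k))))

  factorsThrough-^*^ zero    j       = subst FactorsThrough (sym (*-identityˡ (q ^ j))) (factorsThrough-^ qp j)
  factorsThrough-^*^ (suc i) zero    = subst FactorsThrough (sym (*-identityʳ (p ^ suc i))) (factorsThrough-^ pp (suc i))
  factorsThrough-^*^ (suc i) (suc j) = subst FactorsThrough (sym (pq*-pᵢqⱼ i j)) (proj₂ (step i j))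

  -- With n = pⁱ⁺¹qʲ⁺¹ this is Φ_n = (Xⁿ - 1)(X^(n/pq) - 1) / ((X^(n/p) - 1)(X^(n/q) - 1)),
  -- denominators cleared.
  Φ-two-primes-*-E : ∀ i j → Φ (p ^ suc i * q ^ suc j) *ₚ (E (p ^ suc i * q ^ j) *ₚ E (p ^ i * q ^ suc j))
                             ≋ E (p ^ suc i * q ^ suc j) *ₚ E (p ^ i * q ^ j)
  Φ-two-primes-*-E i j rewrite pq*-pᵢqⱼ i j | *-assoc p (p ^ i) (q ^ j) | q*-pᵢqⱼ i j = proj₁ (step i j)

-- Sums over A of periodic functions

∑ : ∀ {M} → Subset M → (ℕ → ℕ) → ℕ
∑ []      g = 0
∑ (b ∷ A) g = (if b then g 0 else 0) + ∑ A (g ∘ suc)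

∑-cong : ∀ {M} (A : Subset M) {g h} → g ≗ h → ∑ A g ≡ ∑ A h
∑-cong []          e = refl
∑-cong (true ∷ A)  e = cong₂ _+_ (e 0) (∑-cong A (e ∘ suc))
∑-cong (false ∷ A) e = ∑-cong A (e ∘ suc)

∑-0 : ∀ {M} (A : Subset M) → ∑ A (const 0) ≡ 0
∑-0 []          = refl
∑-0 (true ∷ A)  = ∑-0 A
∑-0 (false ∷ A) = ∑-0 A

∑-+ : ∀ {M} (A : Subset M) g h → ∑ A (λ a → g a + h a) ≡ ∑ A g + ∑ A h
∑-+ []          g h = refl
∑-+ (true ∷ A)  g h = trans (cong (λ z → g 0 + h 0 + z) (∑-+ A (g ∘ suc) (h ∘ suc))) (lem (g 0) (h 0) _ _)
  where
  lem : ∀ a b c d → (a + b) + (c + d) ≡ (a + c) + (b + d)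
  lem = solve-∀
∑-+ (false ∷ A) g h = ∑-+ A (g ∘ suc) (h ∘ suc)

∑-∣∣ : ∀ {M} (A : Subset M) → ∑ A (const 1) ≡ ∣ A ∣
∑-∣∣ []          = refl
∑-∣∣ (true ∷ A)  = cong suc (∑-∣∣ A)
∑-∣∣ (false ∷ A) = ∑-∣∣ A

-- The bridge from divisibility to counting: the mask polynomial acts on `g` by summing it over
-- translates of `A`.
∑-mask : ∀ {M} (A : Subset M) g n → (mask A ▷ (+_ ∘ g)) n ≡ + ∑ A (λ a → g (n + a))
∑-mask []          g n = refl
∑-mask (true ∷ A)  g n = trans (cong₂ ℤ._+_ (trans (ℤ.*-identityˡ (+ g n)) (cong (+_ ∘ g) (sym (+-identityʳ n)))) (∑-mask A g (suc n)))
  (cong (λ z → + (g (n + 0) + z)) (∑-cong A λ a → cong g (sym (+-suc n a))))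
∑-mask (false ∷ A) g n = trans (ℤ.+-identityˡ _) (trans (∑-mask A g (suc n)) (cong +_ (∑-cong A λ a → cong g (sym (+-suc n a)))))

∑< : ℕ → (ℕ → ℕ) → ℕ
∑< zero    f = 0
∑< (suc n) f = f 0 + ∑< n (f ∘ suc)

∑<-cong : ∀ n {f h} → f ≗ h → ∑< n f ≡ ∑< n h
∑<-cong zero    e = refl
∑<-cong (suc n) e = cong₂ _+_ (e 0) (∑<-cong n (e ∘ suc))

∑<-+ : ∀ n f h → ∑< n (λ l → f l + h l) ≡ ∑< n f + ∑< n h
∑<-+ zero    f h = refl
∑<-+ (suc n) f h = trans (cong (λ z → f 0 + h 0 + z) (∑<-+ n (f ∘ suc) (h ∘ suc))) (lem (f 0) (h 0) _ _)
  where
  lem : ∀ a b c d → (a + b) + (c + d) ≡ (a + c) + (b + d)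
  lem = solve-∀

∑<-const : ∀ n c → ∑< n (const c) ≡ n * c
∑<-const zero    c = refl
∑<-const (suc n) c = cong (λ z → c + z) (∑<-const n c)

∑<-*ʳ : ∀ n f c → ∑< n (λ l → f l * c) ≡ ∑< n f * c
∑<-*ʳ zero    f c = refl
∑<-*ʳ (suc n) f c = trans (cong (λ z → f 0 * c + z) (∑<-*ʳ n (f ∘ suc) c)) (sym (*-distribʳ-+ c (f 0) _))

∑<-*ˡ : ∀ n f c → ∑< n (λ l → c * f l) ≡ c * ∑< n f
∑<-*ˡ n f c = trans (∑<-cong n λ l → *-comm c (f l)) (trans (∑<-*ʳ n f c) (*-comm _ c))

∑<-∑ : ∀ {M} (A : Subset M) n (f : ℕ → ℕ → ℕ) → ∑< n (λ l → ∑ A (f l)) ≡ ∑ A (λ a → ∑< n (λ l → f l a))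
∑<-∑ A zero    f = sym (∑-0 A)
∑<-∑ A (suc n) f = trans (cong (λ z → ∑ A (f 0) + z) (∑<-∑ A n (f ∘ suc))) (sym (∑-+ A (f 0) _))

Periodic : ℕ → (ℕ → ℕ) → Set
Periodic n g = ∀ a l → g (a + l * n) ≡ g a

periodic-∣ : ∀ {n g τ} a → Periodic n g → n ∣ τ → g (a + τ) ≡ g a
periodic-∣ a per (divides l refl) = per a l

periodic-* : ∀ {n g h} → Periodic n g → Periodic n h → Periodic n (λ a → g a * h a)
periodic-* pg ph a l = cong₂ _*_ (pg a l) (ph a l)

periodic-weaken : ∀ {m n g} → m ∣ n → Periodic m g → Periodic n g
periodic-weaken m∣n per a l = periodic-∣ a per (∣n⇒∣m*n l m∣n)

-- Xⁿ - 1 kills every n-periodic sequence, so each multiple of it yields a linear relation between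
-- sums over `A`.
annihilates : ∀ F Y f n {g} → F *ₚ f ≋ Y *ₚ E n → Periodic n g → (F ▷ (f ▷ (+_ ∘ g))) 0 ≡ 0ℤ
annihilates F Y f n {g} e per = trans (sym (*-▷ F f _ 0)) (trans (▷-≡ e _ 0) (trans (*-▷ Y (E n) _ 0)
  (▷-zeroʳ Y (λ k → trans (E-▷ n _ k) (trans (cong (λ z → + z ℤ.- + g k) (trans (cong (λ z → g (k + z)) (sym (*-identityˡ n))) (per k 1)))
     (ℤ.+-inverseʳ (+ g k)))) 0)))

module _ {M} (A : Subset M) where

  mask-▷-shift : ∀ g τ → (mask A ▷ (E τ ▷ (+_ ∘ g))) 0 ≡ + ∑ A (λ a → g (a + τ)) ℤ.- + ∑ A g
  mask-▷-shift g τ = begin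
    (mask A ▷ (E τ ▷ (+_ ∘ g))) 0
      ≡⟨ ▷-cong (mask A) (λ k → trans (E-▷ τ _ k) (lem (+ g (k + τ)) (+ g k))) 0 ⟩
    (mask A ▷ (λ k → -1ℤ ℤ.* (+ g k) ℤ.+ (+ g (k + τ)))) 0
      ≡⟨ ▷-linearʳ (mask A) -1ℤ (+_ ∘ g) (λ k → + g (k + τ)) 0 ⟩
    -1ℤ ℤ.* (mask A ▷ (+_ ∘ g)) 0 ℤ.+ (mask A ▷ (λ k → + g (k + τ))) 0
      ≡⟨ cong₂ (λ x y → -1ℤ ℤ.* x ℤ.+ y) (∑-mask A g 0) (∑-mask A (λ k → g (k + τ)) 0) ⟩
    -1ℤ ℤ.* + ∑ A g ℤ.+ + ∑ A (λ a → g (a + τ))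
      ≡⟨ lem (+ ∑ A (λ a → g (a + τ))) (+ ∑ A g) ⟨
    + ∑ A (λ a → g (a + τ)) ℤ.- + ∑ A g ∎
    where
    open ≡-Reasoning
    lem : ∀ x y → x ℤ.- y ≡ -1ℤ ℤ.* y ℤ.+ x
    lem = ℤ.solve-∀

  -- X^τ - 1 is a multiple of X^(pⁱ) - 1, which Φ completes to X^(pⁱ⁺¹) - 1. In other words, `A` is
  -- equidistributed among the p lifts mod pⁱ⁺¹ of each class mod pⁱ.
  shift-invariant : ∀ {p} i → Prime p → Φ (p ^ suc i) ∣ₚ mask A → ∀ g τ → Periodic (p ^ suc i) g → p ^ i ∣ τ →
                    ∑ A (λ a → g (a + τ)) ≡ ∑ A g
  shift-invariant {p} i pp (r , e) g τ per (divides l refl) = ℤ.+-injective (ℤ.i-j≡0⇒i≡j _ _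
    (trans (sym (mask-▷-shift g τ)) (annihilates (mask A) (r *ₚ repunit l (p ^ i)) (E (l * p ^ i)) (p ^ suc i) (begin
      mask A *ₚ E (l * p ^ i)                               ≈⟨ R.*-cong {r *ₚ Φ (p ^ suc i)} {mask A} (≈⇒≋ e) (repunit-*-E l (p ^ i)) ⟨
      r *ₚ Φ (p ^ suc i) *ₚ (repunit l (p ^ i) *ₚ E (p ^ i))   ≈⟨ interchange r _ _ _ ⟩
      r *ₚ repunit l (p ^ i) *ₚ (Φ (p ^ suc i) *ₚ E (p ^ i))   ≈⟨ R.*-congˡ {r *ₚ repunit l (p ^ i)} (Φ-prime-power-*-E pp i) ⟩
      r *ₚ repunit l (p ^ i) *ₚ E (p ^ suc i)                ∎) per)))
    where
    open import Algebra.Properties.CommutativeSemigroup R.*-commutativeSemigroup using (interchange)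
    open import Relation.Binary.Reasoning.Setoid R.setoid

  -- The product (X^υ - 1)(X^τ - 1) is a multiple of the two denominators in `Φ-two-primes-*-E`. So
  -- `A` times this product is a multiple of Xⁿ - 1, and the mixed second difference of the sums
  -- vanishes.
  rectangle : ∀ {p q} i j → Prime p → Prime q → p ≢ q → Φ (p ^ suc i * q ^ suc j) ∣ₚ mask A →
              ∀ g τ υ → Periodic (p ^ suc i * q ^ suc j) g → p ^ i * q ^ suc j ∣ τ → p ^ suc i * q ^ j ∣ υ →
              ∑ A (λ a → g (a + υ + τ)) + ∑ A g ≡ ∑ A (λ a → g (a + τ)) + ∑ A (λ a → g (a + υ))
  rectangle {p} {q} i j pp qp p≢q (r , e) g τ υ per (divides k eτ) (divides l eυ) =
    trans (sym (∑-+ A (λ a → g (a + υ + τ)) g)) (trans (ℤ.+-injective (ℤ.i-j≡0⇒i≡j _ _ vanishes)) (∑-+ A (λ a → g (a + τ)) (λ a → g (a + υ))))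
    where
    n = p ^ suc i * q ^ suc j
    E₀ = E (p ^ i * q ^ j)
    Eτ = E (p ^ i * q ^ suc j)
    Eυ = E (p ^ suc i * q ^ j)
    ρ = repunit l (p ^ suc i * q ^ j) *ₚ repunit k (p ^ i * q ^ suc j)
    divisible : ∀ r k {n} → n ≡ r * k → repunit r k *ₚ E k ≋ E n
    divisible r k refl = repunit-*-E r k
    multiple : mask A *ₚ (E υ *ₚ E τ) ≋ r *ₚ ρ *ₚ E₀ *ₚ E n
    multiple = begin
      mask A *ₚ (E υ *ₚ E τ)
        ≈⟨ R.*-cong {r *ₚ Φ n} {mask A} (≈⇒≋ e) (R.*-cong (divisible l (p ^ suc i * q ^ j) eυ) (divisible k (p ^ i * q ^ suc j) eτ)) ⟨
      r *ₚ Φ n *ₚ ((repunit l (p ^ suc i * q ^ j) *ₚ Eυ) *ₚ (repunit k (p ^ i * q ^ suc j) *ₚ Eτ))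
        ≈⟨ R.*-congˡ {r *ₚ Φ n} (interchange (repunit l (p ^ suc i * q ^ j)) Eυ _ Eτ) ⟩
      r *ₚ Φ n *ₚ (ρ *ₚ (Eυ *ₚ Eτ))
        ≈⟨ interchange r (Φ n) ρ _ ⟩
      r *ₚ ρ *ₚ (Φ n *ₚ (Eυ *ₚ Eτ))
        ≈⟨ R.*-congˡ {r *ₚ ρ} (R.trans (Φ-two-primes-*-E pp qp p≢q i j) (R.*-comm (E n) E₀)) ⟩
      r *ₚ ρ *ₚ (E₀ *ₚ E n)
        ≈⟨ R.*-assoc (r *ₚ ρ) E₀ (E n) ⟨
      r *ₚ ρ *ₚ E₀ *ₚ E n ∎
      where
      open import Algebra.Properties.CommutativeSemigroup R.*-commutativeSemigroup using (interchange)
      open import Relation.Binary.Reasoning.Setoid R.setoid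
    diag anti : ℕ → ℕ
    diag a = g (a + υ + τ) + g a
    anti a = g (a + τ) + g (a + υ)
    vanishes : + ∑ A diag ℤ.- + ∑ A anti ≡ 0ℤ
    vanishes = begin
      + ∑ A diag ℤ.- + ∑ A anti
        ≡⟨ sub (+ ∑ A diag) (+ ∑ A anti) ⟩
      -1ℤ ℤ.* + ∑ A anti ℤ.+ + ∑ A diag
        ≡⟨ cong₂ (λ x y → -1ℤ ℤ.* x ℤ.+ y) (∑-mask A anti 0) (∑-mask A diag 0) ⟨
      -1ℤ ℤ.* (mask A ▷ (+_ ∘ anti)) 0 ℤ.+ (mask A ▷ (+_ ∘ diag)) 0
        ≡⟨ ▷-linearʳ (mask A) -1ℤ (+_ ∘ anti) (+_ ∘ diag) 0 ⟨
      (mask A ▷ (λ a → -1ℤ ℤ.* + anti a ℤ.+ + diag a)) 0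
        ≡⟨ ▷-cong (mask A) second-difference 0 ⟨
      (mask A ▷ ((E υ *ₚ E τ) ▷ (+_ ∘ g))) 0
        ≡⟨ annihilates (mask A) (r *ₚ ρ *ₚ E₀) (E υ *ₚ E τ) n multiple per ⟩
      0ℤ ∎
      where
      open ≡-Reasoning
      sub : ∀ x y → x ℤ.- y ≡ -1ℤ ℤ.* y ℤ.+ x
      sub = ℤ.solve-∀
      regroup : ∀ x y z w → (x ℤ.- y) ℤ.- (z ℤ.- w) ≡ -1ℤ ℤ.* (z ℤ.+ y) ℤ.+ (x ℤ.+ w)
      regroup = ℤ.solve-∀
      second-difference : ∀ a → ((E υ *ₚ E τ) ▷ (+_ ∘ g)) a ≡ -1ℤ ℤ.* + anti a ℤ.+ + diag a
      second-difference a = trans (*-▷ (E υ) (E τ) _ a) (trans (E-▷ υ (E τ ▷ (+_ ∘ g)) a)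
        (trans (cong₂ ℤ._-_ (E-▷ τ (+_ ∘ g) (a + υ)) (E-▷ τ (+_ ∘ g) a))
               (regroup (+ g (a + υ + τ)) (+ g (a + υ)) (+ g (a + τ)) (+ g a))))

-- The steps along a fibre are only required to be ≡ pⁱ mod pⁱ⁺¹, so that they
-- can be chosen divisible by any power of q.
Fibred : (p i : ℕ) → (g h : ℕ → ℕ) → Set
Fibred p i g h = ∀ a e → ∑< p (λ l → g (a + l * (p ^ i * (1 + p * e)))) ≡ h a

fibred-resp : ∀ {p i g g′ h h′} → g ≗ g′ → h ≗ h′ → Fibred p i g h → Fibred p i g′ h′
fibred-resp {p} eg eh F a e = trans (sym (∑<-cong p λ l → eg _)) (trans (F a e) (eh a))

fibred-* : ∀ {p i g h k} → Periodic (p ^ i) k → Fibred p i g h → Fibred p i (λ a → g a * k a) (λ a → h a * k a)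
fibred-* {p} {i} {g} {h} {k} per F a e = begin
  ∑< p (λ l → g (a + l * τ) * k (a + l * τ))   ≡⟨ ∑<-cong p (λ l → cong (g (a + l * τ) *_) (periodic-∣ a per (∣n⇒∣m*n l (m∣m*n _)))) ⟩
  ∑< p (λ l → g (a + l * τ) * k a)             ≡⟨ ∑<-*ʳ p (λ l → g (a + l * τ)) (k a) ⟩
  ∑< p (λ l → g (a + l * τ)) * k a             ≡⟨ cong (_* k a) (F a e) ⟩
  h a * k a                                    ∎
  where
  open ≡-Reasoning
  τ = p ^ i * (1 + p * e)

inverse-mod : ∀ {p n} → Prime p → Coprime p n → ∃ λ e → n ∣ 1 + p * e
inverse-mod {p} {n} pp cop with coprime-Bézout cop
... | Bézout.-+ x y eq = x , divides y (trans (cong suc (*-comm p x)) eq)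
... | Bézout.+- (suc x) y eq with p | ℕ.nonTrivial⇒n>1 p {{prime⇒nonTrivial pp}}
...   | suc zero    | s≤s ()
-- Here yn ≡ -1 mod p, so multiplying by p - 1 = 1 + r turns the residue into 1.
...   | suc (suc r) | _ = r + (1 + r) * x , divides ((1 + r) * y) (begin
    1 + (2 + r) * (r + (1 + r) * x)     ≡⟨ lem₁ r x ⟩
    (1 + r) * ((1 + r) + x * (2 + r))   ≡⟨ cong ((1 + r) *_) (suc-injective eq) ⟨
    (1 + r) * (y * n)                   ≡⟨ *-assoc (1 + r) y n ⟨
    (1 + r) * y * n                     ∎)
  where
  open ≡-Reasoning
  lem₁ : ∀ r x → 1 + (2 + r) * (r + (1 + r) * x) ≡ (1 + r) * ((1 + r) + x * (2 + r))
  lem₁ = solve-∀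

module _ {M} (A : Subset M) where

  -- The p translates of `g` along a fibre have equal sums over `A` by `shift-invariant`, and
  -- together they add up to `h`.
  ∑-fibred : ∀ {p} i → Prime p → Φ (p ^ suc i) ∣ₚ mask A → ∀ {g h} → Periodic (p ^ suc i) g → Fibred p i g h →
             p * ∑ A g ≡ ∑ A h
  ∑-fibred {p} i pp Φ∣A {g} {h} per F = begin
    p * ∑ A g                                      ≡⟨ ∑<-const p (∑ A g) ⟨
    ∑< p (const (∑ A g))                           ≡⟨ ∑<-cong p (λ l → shift-invariant A i pp Φ∣A g (l * τ) per (∣n⇒∣m*n l (m∣m*n _))) ⟨
    ∑< p (λ l → ∑ A (λ a → g (a + l * τ)))         ≡⟨ ∑<-∑ A p (λ l a → g (a + l * τ)) ⟩
    ∑ A (λ a → ∑< p (λ l → g (a + l * τ)))         ≡⟨ ∑-cong A (λ a → F a 0) ⟩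
    ∑ A h                                          ∎
    where
    open ≡-Reasoning
    τ = p ^ i * (1 + p * 0)

  -- Sum `rectangle` over all pq pairs of steps. The step τ is ≡ pⁱ mod pⁱ⁺¹ and divisible by qʲ⁺¹,
  -- so it moves `g` along its fibre and fixes `h`; the step υ does the opposite.
  ∑-fibred² : ∀ {p q} i j → Prime p → Prime q → p ≢ q → Φ (p ^ suc i * q ^ suc j) ∣ₚ mask A →
    ∀ {g g′ h h′} → Periodic (p ^ suc i) g → Periodic (q ^ suc j) h → Fibred p i g g′ → Fibred q j h h′ →
    ∑ A (λ a → g′ a * h′ a) + p * q * ∑ A (λ a → g a * h a) ≡
    q * ∑ A (λ a → g′ a * h a) + p * ∑ A (λ a → g a * h′ a)
  ∑-fibred² {p} {q} i j pp qp p≢q Φ∣A {g} {g′} {h} {h′} pg ph Fg Fh = begin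
    ∑ A (λ a → g′ a * h′ a) + p * q * ∑ A gh
      ≡⟨ cong₂ _+_ (∑-cong A λ a → trans (cong₂ _*_ (sym (Fg a e)) (sym (Fh a f))) (sym (product a))) (sym const²) ⟩
    ∑ A (λ a → ∑< p (λ k → ∑< q (λ l → G k a * H l a))) + ∑< p (λ _ → ∑< q (λ _ → ∑ A gh))
      ≡⟨ cong (_+ ∑< p (λ _ → ∑< q (λ _ → ∑ A gh))) (sym (exchange (λ k l a → G k a * H l a))) ⟩
    ∑< p (λ k → ∑< q (λ l → ∑ A (λ a → G k a * H l a))) + ∑< p (λ _ → ∑< q (λ _ → ∑ A gh))
      ≡⟨ sym (∑<²-+ _ _) ⟩
    ∑< p (λ k → ∑< q (λ l → ∑ A (λ a → G k a * H l a) + ∑ A gh))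
      ≡⟨ ∑<-cong p (λ k → ∑<-cong q (λ l → corners k l)) ⟩
    ∑< p (λ k → ∑< q (λ l → ∑ A (λ a → G k a * h a) + ∑ A (λ a → g a * H l a)))
      ≡⟨ ∑<²-+ _ _ ⟩
    ∑< p (λ k → ∑< q (λ l → ∑ A (λ a → G k a * h a))) + ∑< p (λ k → ∑< q (λ l → ∑ A (λ a → g a * H l a)))
      ≡⟨ cong₂ _+_ left right ⟩
    q * ∑ A (λ a → g′ a * h a) + p * ∑ A (λ a → g a * h′ a) ∎
    where
    open ≡-Reasoning
    coprime-^ : ∀ {p q} → Prime p → Prime q → p ≢ q → ∀ j → Coprime p (q ^ j)
    coprime-^ pp qp p≢q j = prime∤⇒coprime pp (p≢q ∘ prime∣^⇒≡ j pp qp)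
    e-inv = inverse-mod pp (coprime-^ pp qp p≢q (suc j))
    f-inv = inverse-mod qp (coprime-^ qp pp (p≢q ∘ sym) (suc i))
    e = proj₁ e-inv
    f = proj₁ f-inv
    τ = p ^ i * (1 + p * e)
    υ = q ^ j * (1 + q * f)
    τ-dvd : p ^ i * q ^ suc j ∣ τ
    τ-dvd = *-monoʳ-∣ (p ^ i) (proj₂ e-inv)
    υ-dvd : p ^ suc i * q ^ j ∣ υ
    υ-dvd = subst (p ^ suc i * q ^ j ∣_) (*-comm (1 + q * f) (q ^ j)) (*-monoˡ-∣ (q ^ j) (proj₂ f-inv))
    gh : ℕ → ℕ
    gh a = g a * h a
    G H : ℕ → ℕ → ℕ
    G k a = g (a + k * τ)
    H l a = h (a + l * υ)
    product : ∀ a → ∑< p (λ k → ∑< q (λ l → G k a * H l a)) ≡ ∑< p (λ k → G k a) * ∑< q (λ l → H l a)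
    product a = trans (∑<-cong p λ k → ∑<-*ˡ q (λ l → H l a) (G k a)) (∑<-*ʳ p (λ k → G k a) _)
    const² : ∑< p (λ _ → ∑< q (λ _ → ∑ A gh)) ≡ p * q * ∑ A gh
    const² = trans (∑<-const p _) (trans (cong (p *_) (∑<-const q _)) (sym (*-assoc p q _)))
    exchange : ∀ (F : ℕ → ℕ → ℕ → ℕ) → ∑< p (λ k → ∑< q (λ l → ∑ A (F k l))) ≡ ∑ A (λ a → ∑< p (λ k → ∑< q (λ l → F k l a)))
    exchange F = trans (∑<-cong p λ k → ∑<-∑ A q (F k)) (∑<-∑ A p (λ k a → ∑< q (λ l → F k l a)))
    ∑<²-+ : ∀ (u v : ℕ → ℕ → ℕ) → ∑< p (λ k → ∑< q (λ l → u k l + v k l)) ≡ ∑< p (λ k → ∑< q (u k)) + ∑< p (λ k → ∑< q (v k))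
    ∑<²-+ u v = trans (∑<-cong p λ k → ∑<-+ q (u k) (v k)) (∑<-+ p _ _)
    left : ∑< p (λ k → ∑< q (λ l → ∑ A (λ a → G k a * h a))) ≡ q * ∑ A (λ a → g′ a * h a)
    left = trans (∑<-cong p λ k → ∑<-const q _) (trans (∑<-*ˡ p (λ k → ∑ A (λ a → G k a * h a)) q) (cong (q *_)
      (trans (∑<-∑ A p (λ k a → G k a * h a)) (∑-cong A λ a → trans (∑<-*ʳ p (λ k → G k a) (h a)) (cong (_* h a) (Fg a e))))))
    right : ∑< p (λ k → ∑< q (λ l → ∑ A (λ a → g a * H l a))) ≡ p * ∑ A (λ a → g a * h′ a)
    right = trans (∑<-const p _) (cong (p *_)
      (trans (∑<-∑ A q (λ l a → g a * H l a)) (∑-cong A λ a → trans (∑<-*ˡ q (λ l → H l a) (g a)) (cong (g a *_) (Fh a f)))))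
    g-υ : ∀ a l → g (a + l * υ) ≡ g a
    g-υ a l = periodic-∣ a pg (∣n⇒∣m*n l (∣-trans (m∣m*n (q ^ j)) υ-dvd))
    h-τ : ∀ a k → h (a + k * τ) ≡ h a
    h-τ a k = periodic-∣ a ph (∣n⇒∣m*n k (∣-trans (n∣m*n (p ^ i)) τ-dvd))
    corners : ∀ k l → ∑ A (λ a → G k a * H l a) + ∑ A gh ≡ ∑ A (λ a → G k a * h a) + ∑ A (λ a → g a * H l a)
    corners k l = begin
      ∑ A (λ a → G k a * H l a) + ∑ A gh
        ≡⟨ cong (_+ ∑ A gh) (∑-cong A λ a → sym (cong₂ _*_ (both a) (h-τ (a + l * υ) k))) ⟩
      ∑ A (λ a → gh (a + l * υ + k * τ)) + ∑ A gh
        ≡⟨ rectangle A i j pp qp p≢q Φ∣A gh (k * τ) (l * υ)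
             (periodic-* (periodic-weaken {g = g} (m∣m*n _) pg) (periodic-weaken {g = h} (n∣m*n (p ^ suc i)) ph)) (∣n⇒∣m*n k τ-dvd) (∣n⇒∣m*n l υ-dvd) ⟩
      ∑ A (λ a → gh (a + k * τ)) + ∑ A (λ a → gh (a + l * υ))
        ≡⟨ cong₂ _+_ (∑-cong A λ a → cong (G k a *_) (h-τ a k)) (∑-cong A λ a → cong (_* H l a) (g-υ a l)) ⟩
      ∑ A (λ a → G k a * h a) + ∑ A (λ a → g a * H l a) ∎
      where
      both : ∀ a → g (a + l * υ + k * τ) ≡ g (a + k * τ)
      both a = trans (cong g (trans (+-assoc a _ _) (trans (cong (λ z → a + z) (+-comm (l * υ) _)) (sym (+-assoc a _ _))))) (g-υ (a + k * τ) l)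

-- Trees of residues

ind : ℕ → ℕ → ℕ
ind x y = if x ≡ᵇ y then 1 else 0

ind-refl : ∀ x → ind x x ≡ 1
ind-refl zero    = refl
ind-refl (suc x) = ind-refl x

ind≢0⇒≡ : ∀ x y → ind x y ≢ 0 → x ≡ y
ind≢0⇒≡ zero    zero    _ = refl
ind≢0⇒≡ zero    (suc y) e = ⊥-elim (e refl)
ind≢0⇒≡ (suc x) zero    e = ⊥-elim (e refl)
ind≢0⇒≡ (suc x) (suc y) e = cong suc (ind≢0⇒≡ x y e)

∑<-ind : ∀ {n d} → d < n → ∑< n (λ l → ind l d) ≡ 1
∑<-ind {suc n} {zero}  _         = cong suc (trans (∑<-const n 0) (*-zeroʳ n))
∑<-ind {suc n} {suc d} (s≤s d<n) = ∑<-ind d<n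

∑<-suc : ∀ n f → ∑< (suc n) f ≡ ∑< n f + f n
∑<-suc zero    f = +-identityʳ (f 0)
∑<-suc (suc n) f = trans (cong (λ z → f 0 + z) (∑<-suc n (f ∘ suc))) (sym (+-assoc (f 0) _ _))

∑<-cong-< : ∀ n {f h} → (∀ l → l < n → f l ≡ h l) → ∑< n f ≡ ∑< n h
∑<-cong-< zero    e = refl
∑<-cong-< (suc n) e = cong₂ _+_ (e 0 (s≤s z≤n)) (∑<-cong-< n λ l l<n → e (suc l) (s≤s l<n))

∑<-rotate : ∀ n f → (∀ x → f (x + n) ≡ f x) → ∀ c → ∑< n (λ l → f (c + l)) ≡ ∑< n f
∑<-rotate n f per zero    = refl
∑<-rotate n f per (suc c) = trans (+-cancelˡ-≡ (f c) _ _ (begin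
  f c + ∑< n (λ l → f (suc c + l))             ≡⟨ cong₂ _+_ (cong f (+-identityʳ c)) (∑<-cong n λ l → cong f (+-suc c l)) ⟨
  ∑< (suc n) (λ l → f (c + l))                 ≡⟨ ∑<-suc n (λ l → f (c + l)) ⟩
  ∑< n (λ l → f (c + l)) + f (c + n)           ≡⟨ cong (λ z → ∑< n (λ l → f (c + l)) + z) (per c) ⟩
  ∑< n (λ l → f (c + l)) + f c                 ≡⟨ +-comm _ (f c) ⟩
  f c + ∑< n (λ l → f (c + l))                 ∎)) (∑<-rotate n f per c)
  where open ≡-Reasoning

module _ {M} (A : Subset M) where

  ≤-∑ : ∀ {g a} → a ∈ₛ A → g (toℕ a) ≤ ∑ A g
  ≤-∑ = go A
    where
    go : ∀ {M} (A : Subset M) {g a} → a ∈ₛ A → g (toℕ a) ≤ ∑ A g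
    go (_ ∷ A) here       = m≤m+n _ _
    go (b ∷ A) (there a∈) = ≤-trans (go A a∈) (m≤n+m _ _)

∑≢0⇒∃ : ∀ {M} (A : Subset M) {g} → ∑ A g ≢ 0 → ∃ λ a → a ∈ₛ A × g (toℕ a) ≢ 0
∑≢0⇒∃ []          ne = ⊥-elim (ne refl)
∑≢0⇒∃ (b ∷ A) {g} ne with ∑ A (g ∘ suc) ≟ 0
... | no  ne′ = let (a , a∈ , nz) = ∑≢0⇒∃ A ne′ in suc a , there a∈ , nz
∑≢0⇒∃ (true ∷ A)  {g} ne | yes e = zero , here , λ g0 → ne (cong₂ _+_ g0 e)
∑≢0⇒∃ (false ∷ A) {g} ne | yes e = ⊥-elim (ne e)

∑≡1⇒unique : ∀ {M} (A : Subset M) {g a b} → ∑ A g ≡ 1 → a ∈ₛ A → b ∈ₛ A →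
             1 ≤ g (toℕ a) → 1 ≤ g (toℕ b) → a ≡ b
∑≡1⇒unique (_ ∷ A) e here here _ _ = refl
∑≡1⇒unique (_ ∷ A) e here (there b∈) ga gb = ⊥-elim (<-irrefl (sym e) (+-mono-≤ ga (≤-trans gb (≤-∑ A b∈))))
∑≡1⇒unique (_ ∷ A) e (there a∈) here ga gb = ⊥-elim (<-irrefl (sym e) (+-mono-≤ gb (≤-trans ga (≤-∑ A a∈))))
∑≡1⇒unique (true ∷ A) {g} e (there a∈) (there b∈) ga gb with g 0
... | zero  = cong suc (∑≡1⇒unique A e a∈ b∈ ga gb)
... | suc _ = ⊥-elim (<-irrefl (sym e) (s≤s (≤-trans (≤-trans ga (≤-∑ A a∈)) (m≤n+m _ _))))
∑≡1⇒unique (false ∷ A) e (there a∈) (there b∈) ga gb = cong suc (∑≡1⇒unique A e a∈ b∈ ga gb)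

-- `U i` is the function of residues mod pⁱ obtained by truncating a tree: a level outside `K`
-- changes nothing, and a level in `K` distributes the value at a residue over its p lifts. The
-- starting level `i₀` admits trees with a fixed digit, which obey these laws only above that digit.
record Filtration (p i₀ : ℕ) (K : ℕ → Bool) (U : ℕ → ℕ → ℕ) : Set where
  field
    periodic : ∀ i → i₀ ≤ i → Periodic (p ^ i) (U i)
    unsplit  : ∀ i → i₀ ≤ i → K i ≡ false → U (suc i) ≗ U i
    fibred   : ∀ i → i₀ ≤ i → K i ≡ true → Fibred p i (U (suc i)) (U i)

module Digits {p} (pp : Prime p) where
  private instance
    _ = prime⇒nonZero pp

  quo rem digit : ℕ → ℕ → ℕ
  quo i a = _/_ a (p ^ i) {{m^n≢0 p i}}
  rem i a = _%_ a (p ^ i) {{m^n≢0 p i}}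
  digit i a = quo i a % p

  digit-< : ∀ i a → digit i a < p
  digit-< i a = m%n<n (quo i a) p

  -- Since 1 + pe ≡ 1 mod p, every step raises the digit by one modulo p, whatever `e` is.
  digit-walk : ∀ i a l e → digit i (a + l * (p ^ i * (1 + p * e))) ≡ (quo i a + l) % p
  digit-walk i a l e = begin
    (a + l * (p ^ i * (1 + p * e))) / p ^ i % p
      ≡⟨ cong (_% p) (+-distrib-/-∣ʳ a (∣n⇒∣m*n l (m∣m*n (1 + p * e)))) ⟩
    (a / p ^ i + l * (p ^ i * (1 + p * e)) / p ^ i) % p
      ≡⟨ cong (λ z → (a / p ^ i + z / p ^ i) % p) (lem₁ l (p ^ i) p e) ⟩
    (a / p ^ i + (l + l * e * p) * p ^ i / p ^ i) % p
      ≡⟨ cong (λ z → (a / p ^ i + z) % p) (m*n/n≡m (l + l * e * p) (p ^ i)) ⟩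
    (a / p ^ i + (l + l * e * p)) % p
      ≡⟨ cong (_% p) (+-assoc (a / p ^ i) l _) ⟨
    (a / p ^ i + l + l * e * p) % p
      ≡⟨ [m+kn]%n≡m%n (a / p ^ i + l) (l * e) p ⟩
    (a / p ^ i + l) % p ∎
    where
    open ≡-Reasoning
    instance _ = m^n≢0 p i
    lem₁ : ∀ l x p e → l * (x * (1 + p * e)) ≡ (l + l * e * p) * x
    lem₁ = solve-∀

  digit-periodic : ∀ i → Periodic (p ^ suc i) (digit i)
  digit-periodic i a l = begin
    (a + l * (p * p ^ i)) / p ^ i % p            ≡⟨ cong (_% p) (+-distrib-/-∣ʳ a (∣n⇒∣m*n l (n∣m*n p))) ⟩
    (a / p ^ i + l * (p * p ^ i) / p ^ i) % p    ≡⟨ cong (λ z → (a / p ^ i + z / p ^ i) % p) (sym (*-assoc l p (p ^ i))) ⟩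
    (a / p ^ i + l * p * p ^ i / p ^ i) % p      ≡⟨ cong (λ z → (a / p ^ i + z) % p) (m*n/n≡m (l * p) (p ^ i)) ⟩
    (a / p ^ i + l * p) % p                      ≡⟨ [m+kn]%n≡m%n (a / p ^ i) l p ⟩
    digit i a                                    ∎
    where
    open ≡-Reasoning
    instance _ = m^n≢0 p i

  ^-∣-≤ : ∀ {i j} → i ≤ j → p ^ i ∣ p ^ j
  ^-∣-≤ {i} {j} i≤j = subst (λ k → p ^ i ∣ p ^ k) (m+[n∸m]≡n i≤j)
    (subst (p ^ i ∣_) (sym (^-distribˡ-+-* p i (j ∸ i))) (m∣m*n _))

  digit-cong : ∀ {i j a b} → i < j → rem j a ≡ rem j b → digit i a ≡ digit i b
  digit-cong {i} {j} {a} {b} i<j e = trans (sym (reduce a)) (trans (cong (digit i) e) (reduce b))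
    where
    instance _ = m^n≢0 p j
    reduce : ∀ a → digit i (rem j a) ≡ digit i a
    reduce a = sym (trans (cong (digit i) (m≡m%n+[m/n]*n a (p ^ j)))
      (periodic-∣ {g = digit i} (a % p ^ j) (digit-periodic i) (∣n⇒∣m*n (a / p ^ j) (^-∣-≤ i<j))))

  -- Along a fibre the digit takes each value below p once, while the prescribed digit `κ` stays
  -- fixed; exactly one of the p points is selected.
  fibred-ind : ∀ i κ → (∀ a → κ a < p) → Periodic (p ^ i) κ → Fibred p i (λ a → ind (digit i a) (κ a)) (const 1)
  fibred-ind i κ κ<p per a e = begin
    ∑< p (λ l → ind (digit i (a + l * τ)) (κ (a + l * τ)))
      ≡⟨ ∑<-cong p (λ l → cong₂ ind (digit-walk i a l e) (periodic-∣ a per (∣n⇒∣m*n l (m∣m*n (1 + p * e))))) ⟩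
    ∑< p (λ l → ind ((quo i a + l) % p) (κ a))
      ≡⟨ ∑<-rotate p (λ x → ind (x % p) (κ a)) (λ x → cong (λ z → ind z (κ a)) ([m+n]%n≡m%n x p)) (quo i a) ⟩
    ∑< p (λ l → ind (l % p) (κ a))
      ≡⟨ ∑<-cong-< p (λ l l<p → cong (λ z → ind z (κ a)) (m<n⇒m%n≡m l<p)) ⟩
    ∑< p (λ l → ind l (κ a))
      ≡⟨ ∑<-ind (κ<p a) ⟩
    1 ∎
    where
    open ≡-Reasoning
    τ = p ^ i * (1 + p * e)

  module _ (K : ℕ → Bool) (b c : ℕ) where

    -- The digits prescribed by a tree through b which also passes through c
    -- whenever b and c are compatible.
    branch : ℕ → ℕ → ℕ
    branch i a = if does (rem i a ≟ rem i b) then digit i b else digit i c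

    level : ℕ → ℕ → ℕ
    level i a = if K i then ind (digit i a) (branch i a) else 1

    -- The indicator function of the tree truncated to the lowest `i` digits.
    tree : ℕ → ℕ → ℕ
    tree zero    a = 1
    tree (suc i) a = tree i a * level i a

    branch-< : ∀ i a → branch i a < p
    branch-< i a with does (rem i a ≟ rem i b)
    ... | true  = digit-< i b
    ... | false = digit-< i c

    branch-periodic : ∀ i → Periodic (p ^ i) (branch i)
    branch-periodic i a l = cong (λ z → if does (z ≟ rem i b) then digit i b else digit i c) ([m+kn]%n≡m%n a l (p ^ i) {{m^n≢0 p i}})

    level-periodic : ∀ i → Periodic (p ^ suc i) (level i)
    level-periodic i a l with K i
    ... | true  = cong₂ ind (digit-periodic i a l) (periodic-weaken (n∣m*n p) (branch-periodic i) a l)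
    ... | false = refl

    tree-periodic : ∀ i → Periodic (p ^ i) (tree i)
    tree-periodic zero    = λ _ _ → refl
    tree-periodic (suc i) = periodic-* {g = tree i} (periodic-weaken {g = tree i} (n∣m*n p) (tree-periodic i)) (level-periodic i)

    tree-filtration : Filtration p 0 K tree
    tree-filtration = record
      { periodic = λ i _ → tree-periodic i
      ; unsplit  = λ i _ Ki a → trans (cong (λ k → tree i a * (if k then ind (digit i a) (branch i a) else 1)) Ki) (*-identityʳ _)
      ; fibred   = λ i _ Ki → fibred-resp {p} {i}
          (λ a → trans (*-comm (ind (digit i a) (branch i a)) (tree i a))
                       (cong (λ k → tree i a * (if k then ind (digit i a) (branch i a) else 1)) (sym Ki)))
          (λ a → *-identityˡ (tree i a))
          (fibred-* {p} {i} {λ a → ind (digit i a) (branch i a)} {const 1} (tree-periodic i) (fibred-ind i (branch i) (branch-< i) (branch-periodic i)))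
      }

    -- The digit at level `α` is determined mod p^(α+1), hence constant along the fibres of all
    -- higher levels; this is why the filtration starts at `suc α`.
    pinned-filtration : ∀ α t → Filtration p (suc α) K (λ i a → tree i a * ind (digit α a) t)
    pinned-filtration α t = record
      { periodic = λ i α<i → periodic-* {g = tree i} (tree-periodic i) (pin-periodic α<i)
      ; unsplit  = λ i _ Ki a → cong (_* ind (digit α a) t) (Filtration.unsplit tree-filtration i z≤n Ki a)
      ; fibred   = λ i α<i Ki → fibred-* {p} {i} {tree (suc i)} {tree i} (pin-periodic α<i) (Filtration.fibred tree-filtration i z≤n Ki)
      }
      where
      pin-periodic : ∀ {i} → α < i → Periodic (p ^ i) (λ a → ind (digit α a) t)
      pin-periodic α<i = periodic-weaken (^-∣-≤ α<i) (λ a l → cong (λ z → ind z t) (digit-periodic α a l))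

    tree-b : ∀ i → tree i b ≡ 1
    tree-b zero    = refl
    tree-b (suc i) = cong₂ _*_ (tree-b i) level≡1
      where
      level≡1 : level i b ≡ 1
      level≡1 with K i
      ... | false = refl
      ... | true rewrite dec-true (rem i b ≟ rem i b) refl = ind-refl (digit i b)

    -- If `b` and `c` have different digits somewhere, the first such level lies outside `K`. This
    -- is exactly when one tree can pass through both.
    Compatible : Set
    Compatible = ∀ i → K i ≡ true → rem i c ≡ rem i b → digit i c ≡ digit i b

    branch-c : Compatible → ∀ i → K i ≡ true → branch i c ≡ digit i c
    branch-c comp i Ki with rem i c ≟ rem i b
    ... | yes e  rewrite dec-true (rem i c ≟ rem i b) e   = sym (comp i Ki e)
    ... | no  ne rewrite dec-false (rem i c ≟ rem i b) ne = refl

    tree-c : Compatible → ∀ i → tree i c ≡ 1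
    tree-c comp zero    = refl
    tree-c comp (suc i) = cong₂ _*_ (tree-c comp i) level≡1
      where
      level≡1 : level i c ≡ 1
      level≡1 with K i in Ki
      ... | false = refl
      ... | true  = trans (cong (ind (digit i c)) (branch-c comp i Ki)) (ind-refl (digit i c))

  -- With `b` in both places, either case of `branch` prescribes the digit of `b`.
  tree≢0⇒digits : ∀ K b {i a} → tree K b b i a ≢ 0 → ∀ {j} → j < i → K j ≡ true → digit j a ≡ digit j b
  tree≢0⇒digits K b {suc i} {a} ne {j} (s≤s j≤i) Kj with m≤n⇒m<n∨m≡n j≤i
  ... | inj₁ j<i  = tree≢0⇒digits K b {i} (λ e → ne (cong (_* level K b b i a) e)) j<i Kj
  ... | inj₂ refl with does (rem i a ≟ rem i b)
  ...   | true  rewrite Kj = ind≢0⇒≡ _ _ λ e → ne (trans (cong (λ z → tree K b b i a * z) e) (*-zeroʳ (tree K b b i a)))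
  ...   | false rewrite Kj = ind≢0⇒≡ _ _ λ e → ne (trans (cong (λ z → tree K b b i a * z) e) (*-zeroʳ (tree K b b i a)))

  -- Below `α` the digits at levels of `K` agree, `α` itself is not in `K`, and above `α` the
  -- residues already differ, so that nothing is required there.
  split-at⇒compatible : ∀ {K} α {b c} → K α ≡ false → (∀ i → i < α → K i ≡ true → digit i c ≡ digit i b) →
                        digit α c ≢ digit α b → Compatible K b c
  split-at⇒compatible α Kα below at i Ki e with <-cmp i α
  ... | tri< i<α _ _ = below i i<α Ki
  ... | tri≈ _ refl _ with () ← trans (sym Ki) Kα
  ... | tri> _ _ α<i = ⊥-elim (at (digit-cong α<i e))

-- Counting A in products of trees

factor : ℕ → (ℕ → Bool) → ℕ → ℕ
factor p K i = if K i then p else 1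

-- p to the number of levels i in `K` with i₀ ≤ i < i₀ + k.
weight : ℕ → (ℕ → Bool) → ℕ → ℕ → ℕ
weight p K i₀ zero    = 1
weight p K i₀ (suc k) = weight p K i₀ k * factor p K (k + i₀)

weight-+ : ∀ p K i₀ i k → weight p K i₀ (k + i) ≡ weight p K i₀ i * weight p K (i + i₀) k
weight-+ p K i₀ i zero    = sym (*-identityʳ _)
weight-+ p K i₀ i (suc k) = trans (cong₂ _*_ (weight-+ p K i₀ i k) (cong (factor p K) (+-assoc k i i₀)))
                                  (*-assoc (weight p K i₀ i) _ _)

weight-power : ∀ p K i₀ k → ∃ λ e → weight p K i₀ k ≡ p ^ e
weight-power p K i₀ zero    = 0 , refl
weight-power p K i₀ (suc k) with K (k + i₀) | weight-power p K i₀ k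
... | true  | e , eq = suc e , trans (cong (_* p) eq) (*-comm _ p)
... | false | e , eq = e , trans (*-identityʳ _) eq

weight≢0 : ∀ p .{{_ : NonZero p}} K i₀ k → NonZero (weight p K i₀ k)
weight≢0 p K i₀ k = let (e , eq) = weight-power p K i₀ k in subst NonZero (sym eq) (m^n≢0 p e)

-- Unit squares are glued first into a row, then rows into a rectangle. Each relation is a
-- comparison of two sums because subtraction in ℕ is truncated.
additive-rectangle : (c : ℕ → ℕ → ℕ) → ∀ k l →
  (∀ i j → c (suc i) (suc j) + c i j ≡ c (suc i) j + c i (suc j)) →
  c k l + c 0 0 ≡ c k 0 + c 0 l
additive-rectangle c zero    l sq = +-comm (c 0 l) (c 0 0)
additive-rectangle c (suc k) l sq = +-cancelʳ-≡ (c k l + c k 0) _ _ (begin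
  c (suc k) l + c 0 0 + (c k l + c k 0)          ≡⟨ lem₁ (c (suc k) l) (c 0 0) (c k l) (c k 0) ⟩
  (c (suc k) l + c k 0) + (c k l + c 0 0)        ≡⟨ cong₂ _+_ (row l) (additive-rectangle c k l sq) ⟩
  (c (suc k) 0 + c k l) + (c k 0 + c 0 l)        ≡⟨ lem₂ (c (suc k) 0) (c k l) (c k 0) (c 0 l) ⟩
  c (suc k) 0 + c 0 l + (c k l + c k 0)          ∎)
  where
  open ≡-Reasoning
  lem₁ : ∀ a b c d → a + b + (c + d) ≡ (a + d) + (c + b)
  lem₁ = solve-∀
  lem₂ : ∀ a b c d → (a + b) + (c + d) ≡ a + d + (b + c)
  lem₂ = solve-∀
  row : ∀ j → c (suc k) j + c k 0 ≡ c (suc k) 0 + c k j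
  row zero    = refl
  row (suc j) = +-cancelʳ-≡ (c k j + c (suc k) j) _ _ (begin
    c (suc k) (suc j) + c k 0 + (c k j + c (suc k) j)       ≡⟨ lem₃ (c (suc k) (suc j)) (c k 0) (c k j) (c (suc k) j) ⟩
    (c (suc k) (suc j) + c k j) + (c (suc k) j + c k 0)     ≡⟨ cong₂ _+_ (sq k j) (row j) ⟩
    (c (suc k) j + c k (suc j)) + (c (suc k) 0 + c k j)     ≡⟨ lem₄ (c (suc k) j) (c k (suc j)) (c (suc k) 0) (c k j) ⟩
    c (suc k) 0 + c k (suc j) + (c k j + c (suc k) j)       ∎)
    where
    lem₃ : ∀ a b c d → a + b + (c + d) ≡ (a + c) + (d + b)
    lem₃ = solve-∀
    lem₄ : ∀ a b c d → (a + b) + (c + d) ≡ c + b + (d + a)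
    lem₄ = solve-∀

-- K i and L j stand for Φ_{p^(i+1)} ∣ A and Φ_{q^(j+1)} ∣ A: levels count from 0.
record Spectrum {M} (A : Subset M) : Set where
  field
    p q       : ℕ
    p-prime   : Prime p
    q-prime   : Prime q
    p≢q       : p ≢ q
    m n       : ℕ
    K L       : ℕ → Bool
    K-bounded : ∀ i → K i ≡ true → i < m
    L-bounded : ∀ j → L j ≡ true → j < n
    p-divisor : ∀ i → K i ≡ true → Φ (p ^ suc i) ∣ₚ mask A
    q-divisor : ∀ j → L j ≡ true → Φ (q ^ suc j) ∣ₚ mask A
    pq-divisor : ∀ i j → K i ≡ true → L j ≡ true → Φ (p ^ suc i * q ^ suc j) ∣ₚ mask A
    size      : ∣ A ∣ ≡ weight p K 0 m * weight q L 0 n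

swap : ∀ {M} {A : Subset M} → Spectrum A → Spectrum A
swap {A = A} S = record
  { p-prime = q-prime ; q-prime = p-prime ; p≢q = p≢q ∘ sym ; m = n ; n = m
  ; K-bounded = L-bounded ; L-bounded = K-bounded ; p-divisor = q-divisor ; q-divisor = p-divisor
  ; pq-divisor = λ i j Li Kj → subst (λ s → Φ s ∣ₚ mask A) (*-comm (p ^ suc j) (q ^ suc i)) (pq-divisor j i Kj Li)
  ; size = trans size (*-comm (weight p K 0 m) _) }
  where open Spectrum S

filtration-restrict : ∀ {p K U} i₀ → Filtration p 0 K U → Filtration p i₀ K U
filtration-restrict i₀ F = record
  { periodic = λ i _ → periodic i z≤n ; unsplit = λ i _ → unsplit i z≤n ; fibred = λ i _ → fibred i z≤n }
  where open Filtration F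

-- The case of one prime: by `∑-fibred` each level in `K` divides the sum by p, and every other
-- level leaves it unchanged.
marginal : ∀ {M} {A : Subset M} (S : Spectrum A) → let open Spectrum S in
  ∀ {U} → Filtration p 0 K U → ∀ k → weight p K 0 k * ∑ A (U (k + 0)) ≡ ∑ A (U 0)
marginal S FU zero  = +-identityʳ _
marginal {A = A} S {U} FU (suc k) with Spectrum.K S (k + 0) in Kk
... | false = trans (cong₂ _*_ (*-identityʳ (weight p K 0 k)) (∑-cong A (unsplit FU (k + 0) z≤n Kk))) (marginal S FU k)
  where
  open Spectrum S
  open Filtration
... | true  = trans (*-assoc (weight p K 0 k) p _) (trans (cong (weight p K 0 k *_)
    (∑-fibred A (k + 0) p-prime (p-divisor (k + 0) Kk)
      (periodic FU (suc k + 0) z≤n) (fibred FU (k + 0) z≤n Kk))) (marginal S FU k))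
  where
  open Spectrum S
  open Filtration

module Counting {M} {A : Subset M} (S : Spectrum A) where
  open Spectrum S
  module 𝐩 = Digits p-prime
  module 𝐪 = Digits q-prime
  open Filtration
  private instance
    _ = prime⇒nonZero p-prime
    _ = prime⇒nonZero q-prime

  module _ {i₀ j₀ U V} (FU : Filtration p i₀ K U) (FV : Filtration q j₀ L V) where

    count : ℕ → ℕ → ℕ
    count k l = ∑ A (λ a → U (k + i₀) a * V (l + j₀) a)

    private
      c : ℕ → ℕ → ℕ
      c k l = weight p K i₀ k * weight q L j₀ l * count k l

    -- At a level outside `K` or `L` the weights and functions do not change, so opposite sides of
    -- the square coincide. When both levels are present, this is `∑-fibred²` multiplied by the
    -- weights.
    unit-square : ∀ k l → c (suc k) (suc l) + c k l ≡ c (suc k) l + c k (suc l)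
    unit-square k l with K (k + i₀) in Kk | L (l + j₀) in Ll
    ... | false | _ = trans (+-comm (w * 1 * _ * count (suc k) (suc l)) (c k l)) (cong₂ _+_ (sym (drop l _)) (drop (suc l) _))
      where
      w = weight p K i₀ k
      drop : ∀ l′ x → w * 1 * x * count (suc k) l′ ≡ w * x * count k l′
      drop l′ x = cong₂ (λ y z → y * x * z) (*-identityʳ w) (∑-cong A λ a → cong (_* V (l′ + j₀) a) (unsplit FU (k + i₀) (m≤n+m i₀ k) Kk a))
    ... | true | false = cong₂ _+_ (drop (suc k) (weight p K i₀ k * p)) (sym (drop k (weight p K i₀ k)))
      where
      v = weight q L j₀ l
      drop : ∀ k′ x → x * (v * 1) * count k′ (suc l) ≡ x * v * count k′ l
      drop k′ x = cong₂ (λ y z → x * y * z) (*-identityʳ v) (∑-cong A λ a → cong (U (k′ + i₀) a *_) (unsplit FV (l + j₀) (m≤n+m j₀ l) Ll a))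
    ... | true | true = begin
      w * p * (v * q) * C₁₁ + w * v * C₀₀       ≡⟨ lem₁ w p v q C₁₁ C₀₀ ⟩
      w * v * (C₀₀ + p * q * C₁₁)               ≡⟨ cong (w * v *_) square ⟩
      w * v * (q * C₀₁ + p * C₁₀)               ≡⟨ lem₂ w p v q C₀₁ C₁₀ ⟩
      w * p * v * C₁₀ + w * (v * q) * C₀₁       ∎
      where
      open ≡-Reasoning
      w = weight p K i₀ k
      v = weight q L j₀ l
      C₀₀ = count k l
      C₁₀ = count (suc k) l
      C₀₁ = count k (suc l)
      C₁₁ = count (suc k) (suc l)
      lem₁ : ∀ w p v q a b → w * p * (v * q) * a + w * v * b ≡ w * v * (b + p * q * a)
      lem₁ = solve-∀
      lem₂ : ∀ w p v q a b → w * v * (q * a + p * b) ≡ w * p * v * b + w * (v * q) * a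
      lem₂ = solve-∀
      square : C₀₀ + p * q * C₁₁ ≡ q * C₀₁ + p * C₁₀
      square = ∑-fibred² A (k + i₀) (l + j₀) p-prime q-prime p≢q (pq-divisor (k + i₀) (l + j₀) Kk Ll)
        (periodic FU (suc k + i₀) (m≤n+m i₀ (suc k))) (periodic FV (suc l + j₀) (m≤n+m j₀ (suc l)))
        (fibred FU (k + i₀) (m≤n+m i₀ k) Kk) (fibred FV (l + j₀) (m≤n+m j₀ l) Ll)

    count-additive : ∀ k l →
      weight p K i₀ k * weight q L j₀ l * count k l + count 0 0 ≡ weight p K i₀ k * count k 0 + weight q L j₀ l * count 0 l
    count-additive k l = begin
      c k l + count 0 0        ≡⟨ cong (λ z → c k l + z) (+-identityʳ (count 0 0)) ⟨
      c k l + c 0 0            ≡⟨ additive-rectangle c k l unit-square ⟩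
      c k 0 + c 0 l            ≡⟨ cong₂ (λ x y → x * count k 0 + y * count 0 l) (*-identityʳ (weight p K i₀ k)) (*-identityˡ (weight q L j₀ l)) ⟩
      weight p K i₀ k * count k 0 + weight q L j₀ l * count 0 l ∎
      where open ≡-Reasoning

  -- In the additivity relation both marginal terms and the corner term equal |A|, which leaves |A|
  -- for the remaining term.
  total : ∀ {U V} → Filtration p 0 K U → Filtration q 0 L V → (∀ a → U 0 a ≡ 1) → (∀ a → V 0 a ≡ 1) →
          ∀ k l → weight p K 0 k * weight q L 0 l * ∑ A (λ a → U k a * V l a) ≡ ∣ A ∣
  total {U} {V} FU FV U₀≡1 V₀≡1 k l = +-cancelʳ-≡ ∣ A ∣ _ _ (begin
    w * v * ∑ A (λ a → U k a * V l a) + ∣ A ∣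
      ≡⟨ cong₂ (λ x y → w * v * x + y) (∑-cong A λ a → cong₂ (λ i j → U i a * V j a) (+-identityʳ k) (+-identityʳ l)) count₀₀ ⟨
    w * v * count FU FV k l + count FU FV 0 0
      ≡⟨ count-additive FU FV k l ⟩
    w * count FU FV k 0 + v * count FU FV 0 l
      ≡⟨ cong₂ (λ x y → w * x + v * y) (∑-cong A λ a → trans (cong (U (k + 0) a *_) (V₀≡1 a)) (*-identityʳ _))
                                       (∑-cong A λ a → trans (cong (_* V (l + 0) a) (U₀≡1 a)) (*-identityˡ _)) ⟩
    w * ∑ A (U (k + 0)) + v * ∑ A (V (l + 0))
      ≡⟨ cong₂ _+_ (trans (marginal S FU k) (trans (∑-cong A U₀≡1) (∑-∣∣ A)))
                   (trans (marginal (swap S) FV l) (trans (∑-cong A V₀≡1) (∑-∣∣ A))) ⟩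
    ∣ A ∣ + ∣ A ∣ ∎)
    where
    open ≡-Reasoning
    w = weight p K 0 k
    v = weight q L 0 l
    count₀₀ : count FU FV 0 0 ≡ ∣ A ∣
    count₀₀ = trans (∑-cong A λ a → cong₂ _*_ (U₀≡1 a) (V₀≡1 a)) (∑-∣∣ A)

  module _ (b c : ℕ) where
    private
      F = 𝐩.tree-filtration K b c
      G = 𝐪.tree-filtration L b c

    -- For complete trees the weight in `total` is the product that (T1) gives for |A|, so it
    -- cancels.
    trees-meet-once : ∑ A (λ a → 𝐩.tree K b c m a * 𝐪.tree L b c n a) ≡ 1
    trees-meet-once = *-cancelˡ-≡ _ 1 (weight p K 0 m * weight q L 0 n) {{m*n≢0 _ _ {{weight≢0 p K 0 m}} {{weight≢0 q L 0 n}}}}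
      (trans (total F G (λ _ → refl) (λ _ → refl) m n) (trans size (sym (*-identityʳ _))))

  compatible⇒≡ : ∀ {b c} → b ∈ₛ A → c ∈ₛ A → 𝐩.Compatible K (toℕ b) (toℕ c) → 𝐪.Compatible L (toℕ b) (toℕ c) → b ≡ c
  compatible⇒≡ {b} {c} b∈ c∈ P Q = ∑≡1⇒unique A (trees-meet-once (toℕ b) (toℕ c)) b∈ c∈
    (≤-reflexive (sym (cong₂ _*_ (𝐩.tree-b K (toℕ b) (toℕ c) m) (𝐪.tree-b L (toℕ b) (toℕ c) n))))
    (≤-reflexive (sym (cong₂ _*_ (𝐩.tree-c K (toℕ b) (toℕ c) P m) (𝐪.tree-c L (toℕ b) (toℕ c) Q n))))

  module Slices (α β : ℕ) (α<m : α < m) (β<n : β < n) (Kα : K α ≡ false) (Lβ : L β ≡ false) (a₀ : ℕ) where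
    U = 𝐩.tree K a₀ a₀
    V = 𝐪.tree L a₀ a₀
    F = 𝐩.tree-filtration K a₀ a₀
    G = 𝐪.tree-filtration L a₀ a₀

    -- The contributions to |A| of the levels above `α` and `β`. By `slice-total` their product is
    -- the number of points of `A` in the product of the truncated trees.
    P′ Q′ : ℕ
    P′ = weight p K (suc α) (m ∸ suc α)
    Q′ = weight q L (suc β) (n ∸ suc β)

    weight-split : ∀ p K {i m} → i ≤ m → weight p K 0 m ≡ weight p K 0 i * weight p K i (m ∸ i)
    weight-split p K {i} {m} i≤m = begin
      weight p K 0 m                                      ≡⟨ cong (weight p K 0) (m∸n+n≡m i≤m) ⟨
      weight p K 0 (m ∸ i + i)                            ≡⟨ weight-+ p K 0 i (m ∸ i) ⟩
      weight p K 0 i * weight p K (i + 0) (m ∸ i)         ≡⟨ cong (λ z → weight p K 0 i * weight p K z (m ∸ i)) (+-identityʳ i) ⟩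
      weight p K 0 i * weight p K i (m ∸ i)               ∎
      where open ≡-Reasoning

    slice-total : ∑ A (λ a → U (suc α) a * V (suc β) a) ≡ P′ * Q′
    slice-total = *-cancelˡ-≡ _ _ (w * v) {{m*n≢0 _ _ {{weight≢0 p K 0 (suc α)}} {{weight≢0 q L 0 (suc β)}}}} (begin
      w * v * ∑ A (λ a → U (suc α) a * V (suc β) a)   ≡⟨ total F G (λ _ → refl) (λ _ → refl) (suc α) (suc β) ⟩
      ∣ A ∣                                           ≡⟨ size ⟩
      weight p K 0 m * weight q L 0 n                 ≡⟨ cong₂ _*_ (weight-split p K α<m) (weight-split q L β<n) ⟩
      (w * P′) * (v * Q′)                             ≡⟨ lem₁ w P′ v Q′ ⟩
      w * v * (P′ * Q′)                               ∎)
      where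
      open ≡-Reasoning
      w = weight p K 0 (suc α)
      v = weight q L 0 (suc β)
      lem₁ : ∀ w a v b → (w * a) * (v * b) ≡ w * v * (a * b)
      lem₁ = solve-∀

    module _ (t : ℕ) where
      slice : ℕ → ℕ → ℕ
      slice i a = U i a * ind (𝐩.digit α a) t

      -- Additivity from the levels `suc α`, `suc β` up to `m`, `n`: the far corner and one margin
      -- carry the factor `P′`, the other margin is the sum assumed to be 0, and so `P′` divides the
      -- near corner.
      slice-∣ : ∑ A (λ a → slice (suc α) a * V n a) ≡ 0 → P′ ∣ ∑ A (λ a → slice (suc α) a * V (suc β) a)
      slice-∣ empty = ∣m+n∣m⇒∣n (divides (count FU FV k 0) (trans (count-additive FU FV k l) (trans
          (cong (λ z → P′ * count FU FV k 0 + Q′ * z) empty′) (trans (cong (λ z → P′ * count FU FV k 0 + z) (*-zeroʳ Q′)) (trans (+-identityʳ _) (*-comm P′ _))))))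
          (divides (Q′ * count FU FV k l) (trans (*-assoc P′ Q′ _) (*-comm P′ _)))
        where
        k = m ∸ suc α
        l = n ∸ suc β
        FU = 𝐩.pinned-filtration K a₀ a₀ α t
        FV = filtration-restrict (suc β) G
        empty′ : count FU FV 0 l ≡ 0
        empty′ = trans (∑-cong A λ a → cong (λ j → slice (suc α) a * V j a) (m∸n+n≡m β<n)) empty

      slice-fibred : t < p → Fibred p α (slice (suc α)) (U α)
      slice-fibred t<p = fibred-resp {p} {α}
        (λ a → trans (*-comm (ind (𝐩.digit α a) t) (U α a)) (cong (_* ind (𝐩.digit α a) t) (sym (Filtration.unsplit F α z≤n Kα a))))
        (λ a → *-identityˡ (U α a))
        (fibred-* {p} {α} {λ a → ind (𝐩.digit α a) t} {const 1} (𝐩.tree-periodic K a₀ a₀ α) (𝐩.fibred-ind α (const t) (λ _ → t<p) (λ _ _ → refl)))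

      slice-periodic : Periodic (p ^ suc α) (slice (suc α))
      slice-periodic = Filtration.periodic (𝐩.pinned-filtration K a₀ a₀ α t) (suc α) ≤-refl

      -- The slice would have Q′ = p · c for an integer c, but Q′ is a power of q.
      slice-≢ : ∑ A (λ a → slice (suc α) a * V n a) ≡ 0 →
                p * ∑ A (λ a → slice (suc α) a * V (suc β) a) ≢ P′ * Q′
      slice-≢ empty e with slice-∣ empty
      ... | divides c eq = p≢q (prime∣^⇒≡ (proj₁ (weight-power q L (suc β) (n ∸ suc β))) p-prime q-prime
            (subst (p ∣_) (proj₂ (weight-power q L (suc β) (n ∸ suc β))) (divides c (sym (*-cancelˡ-≡ _ _ P′ {{weight≢0 p K (suc α) (m ∸ suc α)}} (begin
              P′ * (c * p)  ≡⟨ lem₁ P′ c p ⟩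
              p * (c * P′)  ≡⟨ cong (p *_) eq ⟨
              p * _         ≡⟨ e ⟩
              P′ * Q′       ∎))))))
        where
        open ≡-Reasoning
        lem₁ : ∀ a c p → a * (c * p) ≡ p * (c * a)
        lem₁ = solve-∀

-- Unsupported divisors

*≢0 : ∀ {x y} → x * y ≢ 0 → x ≢ 0 × y ≢ 0
*≢0 {x} {y} ne = (λ { refl → ne refl }) , (λ { refl → ne (*-zeroʳ x) })

another-digit : ∀ {p} → Prime p → ∀ x → ∃ λ t → t < p × t ≢ x
another-digit pp zero    = 1 , ℕ.nonTrivial⇒n>1 _ {{prime⇒nonTrivial pp}} , λ ()
another-digit pp (suc x) = 0 , <-trans (s≤s z≤n) (ℕ.nonTrivial⇒n>1 _ {{prime⇒nonTrivial pp}}) , λ ()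

module Contradiction {M} {A : Subset M} (S : Spectrum A) {α β : ℕ}
  (α<m : α < Spectrum.m S) (β<n : β < Spectrum.n S)
  (Kα : Spectrum.K S α ≡ false) (Lβ : Spectrum.L S β ≡ false)
  (Φ∣A : Φ (Spectrum.p S ^ suc α * Spectrum.q S ^ suc β) ∣ₚ mask A)
  (a₀ : Fin M) (a₀∈A : a₀ ∈ₛ A) where

  open Spectrum S

  private
    module 𝐩 = Digits p-prime
    module 𝐪 = Digits q-prime
    module P = Counting.Slices S α β α<m β<n Kα Lβ (toℕ a₀)
    module Q = Counting.Slices (swap S) β α β<n α<m Lβ Kα (toℕ a₀)

    t-spec = another-digit p-prime (𝐩.digit α (toℕ a₀))
    s-spec = another-digit q-prime (𝐪.digit β (toℕ a₀))
    t = proj₁ t-spec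
    s = proj₁ s-spec

    p-slice = P.slice t (suc α)
    q-slice = Q.slice s (suc β)

    Near : Fin M → Set
    Near a = (∀ i → i < α → K i ≡ true → 𝐩.digit i (toℕ a) ≡ 𝐩.digit i (toℕ a₀)) ×
             (∀ j → j < β → L j ≡ true → 𝐪.digit j (toℕ a) ≡ 𝐪.digit j (toℕ a₀))

    -- a and b first differ at a level at which both trees branch fully.
    separated : ∀ {a b} → a ∈ₛ A → b ∈ₛ A → Near a → Near b →
                𝐩.digit α (toℕ a) ≢ 𝐩.digit α (toℕ b) → 𝐪.digit β (toℕ a) ≢ 𝐪.digit β (toℕ b) → ⊥
    separated {a} {b} a∈ b∈ (Pa , Qa) (Pb , Qb) p≢ q≢ = p≢ (cong (𝐩.digit α ∘ toℕ) (Counting.compatible⇒≡ S a∈ b∈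
      (𝐩.split-at⇒compatible {K} α Kα (λ i i<α Ki → trans (Pb i i<α Ki) (sym (Pa i i<α Ki))) (p≢ ∘ sym))
      (𝐪.split-at⇒compatible {L} β Lβ (λ j j<β Lj → trans (Qb j j<β Lj) (sym (Qa j j<β Lj))) (q≢ ∘ sym))))

    near-a₀ : Near a₀
    near-a₀ = (λ _ _ _ → refl) , (λ _ _ _ → refl)

    p-digits : ∀ {i a} → P.U i a ≢ 0 → ∀ j → j < i → K j ≡ true → 𝐩.digit j a ≡ 𝐩.digit j (toℕ a₀)
    p-digits ne j = 𝐩.tree≢0⇒digits K (toℕ a₀) ne

    q-digits : ∀ {i a} → P.V i a ≢ 0 → ∀ j → j < i → L j ≡ true → 𝐪.digit j a ≡ 𝐪.digit j (toℕ a₀)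
    q-digits ne j = 𝐪.tree≢0⇒digits L (toℕ a₀) ne

    p-slice-digits : ∀ {a} → p-slice a ≢ 0 →
      (∀ j → j < α → K j ≡ true → 𝐩.digit j a ≡ 𝐩.digit j (toℕ a₀)) × 𝐩.digit α a ≡ t
    p-slice-digits {a} ne = let (ne₁ , ne₂) = *≢0 {P.U (suc α) a} ne in
      (λ j j<α → p-digits {suc α} ne₁ j (m≤n⇒m≤1+n j<α)) , ind≢0⇒≡ _ _ ne₂

    q-slice-digits : ∀ {a} → q-slice a ≢ 0 →
      (∀ j → j < β → L j ≡ true → 𝐪.digit j a ≡ 𝐪.digit j (toℕ a₀)) × 𝐪.digit β a ≡ s
    q-slice-digits {a} ne = let (ne₁ , ne₂) = *≢0 {P.V (suc β) a} ne in
      (λ j j<β → q-digits {suc β} ne₁ j (m≤n⇒m≤1+n j<β)) , ind≢0⇒≡ _ _ ne₂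

    ∑≡0 : ∀ {g} → (∀ {a} → a ∈ₛ A → g (toℕ a) ≢ 0 → ⊥) → ∑ A g ≡ 0
    ∑≡0 {g} none with ∑ A g ≟ 0
    ... | yes e = e
    ... | no ne = let (a , a∈ , nz) = ∑≢0⇒∃ A ne in ⊥-elim (none a∈ nz)

    t-not-a₀ : ∀ {x} → x ≡ t → x ≢ 𝐩.digit α (toℕ a₀)
    t-not-a₀ refl = proj₂ (proj₂ t-spec)
    s-not-a₀ : ∀ {x} → x ≡ s → x ≢ 𝐪.digit β (toℕ a₀)
    s-not-a₀ refl = proj₂ (proj₂ s-spec)

    corner-empty : ∑ A (λ a → p-slice a * q-slice a) ≡ 0
    corner-empty = ∑≡0 λ {a} a∈ nz →
      let (ne₁ , ne₂) = *≢0 {p-slice (toℕ a)} nz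
          (Pa , at) = p-slice-digits ne₁
          (Qa , as) = q-slice-digits ne₂
      in separated a∈ a₀∈A (Pa , Qa) near-a₀ (t-not-a₀ at) (s-not-a₀ as)

    -- Such a point agrees with `a₀` at all levels of `L` and differs from it at `α`, outside `K`.
    -- The two are therefore compatible for both primes, hence equal, which the digit `t` forbids.
    p-slice-empty : ∑ A (λ a → p-slice a * P.V n a) ≡ 0
    p-slice-empty = ∑≡0 λ {a} a∈ nz →
      let (ne₁ , ne₂) = *≢0 {p-slice (toℕ a)} nz
          (Pa , at) = p-slice-digits ne₁
      in t-not-a₀ at (cong (𝐩.digit α ∘ toℕ) (Counting.compatible⇒≡ S a∈ a₀∈A
           (𝐩.split-at⇒compatible {K} α Kα (λ i i<α Ki → sym (Pa i i<α Ki)) (t-not-a₀ at ∘ sym))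
           (λ j Lj _ → sym (q-digits {n} ne₂ j (L-bounded j Lj) Lj))))

    q-slice-empty : ∑ A (λ a → q-slice a * P.U m a) ≡ 0
    q-slice-empty = ∑≡0 λ {a} a∈ nz →
      let (ne₁ , ne₂) = *≢0 {q-slice (toℕ a)} nz
          (Qa , as) = q-slice-digits ne₁
      in s-not-a₀ as (cong (𝐪.digit β ∘ toℕ) (Counting.compatible⇒≡ S a∈ a₀∈A
           (λ i Ki _ → sym (p-digits {m} ne₂ i (K-bounded i Ki) Ki))
           (𝐪.split-at⇒compatible {L} β Lβ (λ j j<β Lj → sym (Qa j j<β Lj)) (s-not-a₀ as ∘ sym))))

    -- In the product of the trees truncated at `α` and `β`, `column` counts the points of `A` with
    -- q-digit `s` at level `β`, and `row` those with p-digit `t` at level `α`.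
    column row : ℕ
    column = ∑ A (λ a → P.U α a * q-slice a)
    row    = ∑ A (λ a → p-slice a * P.V β a)

    U-step : ∀ a → P.U (suc α) a ≡ P.U α a
    U-step = Filtration.unsplit P.F α z≤n Kα
    V-step : ∀ a → P.V (suc β) a ≡ P.V β a
    V-step = Filtration.unsplit P.G β z≤n Lβ

    -- `∑-fibred²` at (`α`, `β`), with the slices as selected lifts and the truncated trees as fibre
    -- sums; its pq term is the empty corner.
    balance : P.P′ * P.Q′ ≡ q * column + p * row
    balance = begin
      P.P′ * P.Q′                                                        ≡⟨ P.slice-total ⟨
      ∑ A (λ a → P.U (suc α) a * P.V (suc β) a)                          ≡⟨ ∑-cong A (λ a → cong₂ _*_ (U-step a) (V-step a)) ⟩
      ∑ A (λ a → P.U α a * P.V β a)                                      ≡⟨ +-identityʳ _ ⟨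
      ∑ A (λ a → P.U α a * P.V β a) + 0                                  ≡⟨ cong (λ z → ∑ A (λ a → P.U α a * P.V β a) + z) (trans (cong (λ z → p * q * z) corner-empty) (*-zeroʳ (p * q))) ⟨
      ∑ A (λ a → P.U α a * P.V β a) + p * q * ∑ A (λ a → p-slice a * q-slice a)
        ≡⟨ ∑-fibred² A α β p-prime q-prime p≢q Φ∣A (P.slice-periodic t) (Q.slice-periodic s)
             (P.slice-fibred t (proj₁ (proj₂ t-spec))) (Q.slice-fibred s (proj₁ (proj₂ s-spec))) ⟩
      q * column + p * row                                               ∎
      where open ≡-Reasoning

    column-empty⇒⊥ : column ≡ 0 → ⊥
    column-empty⇒⊥ e = P.slice-≢ t p-slice-empty (begin
      p * ∑ A (λ a → p-slice a * P.V (suc β) a)    ≡⟨ cong (p *_) (∑-cong A λ a → cong (p-slice a *_) (V-step a)) ⟩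
      p * row                                      ≡⟨ cong (_+ p * row) (trans (cong (q *_) e) (*-zeroʳ q)) ⟨
      q * column + p * row                         ≡⟨ balance ⟨
      P.P′ * P.Q′                                  ∎)
      where open ≡-Reasoning

    row-empty⇒⊥ : row ≡ 0 → ⊥
    row-empty⇒⊥ e = Q.slice-≢ s q-slice-empty (begin
      q * ∑ A (λ a → q-slice a * P.U (suc α) a)    ≡⟨ cong (q *_) (∑-cong A λ a → trans (*-comm (q-slice a) _) (cong (_* q-slice a) (U-step a))) ⟩
      q * column                                   ≡⟨ +-identityʳ _ ⟨
      q * column + 0                               ≡⟨ cong (λ z → q * column + z) (trans (cong (p *_) e) (*-zeroʳ p)) ⟨
      q * column + p * row                         ≡⟨ balance ⟨
      P.P′ * P.Q′                                  ≡⟨ *-comm P.P′ P.Q′ ⟩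
      P.Q′ * P.P′                                  ∎)
      where open ≡-Reasoning

  absurd : ⊥
  absurd with column ≟ 0 | row ≟ 0
  ... | yes e | _     = column-empty⇒⊥ e
  ... | no _  | yes e = row-empty⇒⊥ e
  -- Now `a` has q-digit `s` and `b` has p-digit `t`. If their p-digits agree, `a` is separated from
  -- `a₀`; if their q-digits agree, `b` is; otherwise `a` and `b` are separated from each other.
  ... | no ne | no ne′ =
    let (a , a∈ , nz)  = ∑≢0⇒∃ A ne
        (b , b∈ , nz′) = ∑≢0⇒∃ A ne′
        (na₁ , na₂) = *≢0 {P.U α (toℕ a)} nz
        (nb₁ , nb₂) = *≢0 {p-slice (toℕ b)} nz′
        (Qa , as) = q-slice-digits na₂
        (Pb , bt) = p-slice-digits nb₁
        near-a = p-digits {α} na₁ , Qa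
        near-b = Pb , q-digits {β} nb₂
    in separated a∈ b∈ near-a near-b
         (λ e → separated a∈ a₀∈A near-a near-a₀ (t-not-a₀ (trans e bt)) (s-not-a₀ as))
         (λ e → separated b∈ a₀∈A near-b near-a₀ (t-not-a₀ bt) (s-not-a₀ (trans (sym e) as)))

-- From (T1) and (T2) to the counting data

strip : ∀ {p} → Prime p → ∀ n .{{_ : NonZero n}} → ∃₂ λ x n′ → n ≡ p ^ x * n′ × ¬ p ∣ n′
strip {p} pp = <-rec (λ n → .{{_ : NonZero n}} → ∃₂ λ x n′ → n ≡ p ^ x * n′ × ¬ p ∣ n′) go
  where
  go : ∀ n → (∀ {k} → k < n → .{{_ : NonZero k}} → ∃₂ λ x n′ → k ≡ p ^ x * n′ × ¬ p ∣ n′) →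
       .{{_ : NonZero n}} → ∃₂ λ x n′ → n ≡ p ^ x * n′ × ¬ p ∣ n′
  go n rec with p ∣? n
  ... | no p∤n = 0 , n , sym (*-identityˡ n) , p∤n
  ... | yes (divides k n≡kp) =
    let instance _ = m*n≢0⇒m≢0 k {{subst NonZero n≡kp it}}
        (x , n′ , e , p∤) = rec (subst (k <_) (sym (trans n≡kp (*-comm k p))) (k<p*k k pp))
    in suc x , n′ , trans n≡kp (trans (*-comm k p) (trans (cong (p *_) e) (sym (*-assoc p (p ^ x) n′)))) , p∤

^∣-bound : ∀ {p x m N} → Prime p → ¬ p ∣ N → p ^ x ∣ p ^ m * N → x ≤ m
^∣-bound {p} {x} {m} {N} pp p∤N d = ≮⇒≥ λ m<x → p∤N (*-cancelˡ-∣ (p ^ m) {{m^n≢0 p m {{prime⇒nonZero pp}}}}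
  (∣-trans (subst (p ^ m * p ∣_) (trans (sym (^-distribˡ-+-* p (suc m) (x ∸ suc m))) (cong (p ^_) (m+[n∸m]≡n m<x)))
    (subst (_∣ p * p ^ m * p ^ (x ∸ suc m)) (*-comm p (p ^ m)) (m∣m*n _))) d))

∏ℤ : List ℤ → ℤ
∏ℤ = foldr ℤ._*_ 1ℤ

∏ℤ-↭ : ∀ {xs ys : List ℕ} (f : ℕ → ℤ) → xs ↭ ys → ∏ℤ (map f xs) ≡ ∏ℤ (map f ys)
∏ℤ-↭ f Perm.refl          = refl
∏ℤ-↭ f (Perm.prep x r)    = cong (f x ℤ.*_) (∏ℤ-↭ f r)
∏ℤ-↭ f (Perm.swap x y r)  = trans (cong (λ z → f x ℤ.* (f y ℤ.* z)) (∏ℤ-↭ f r))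
  (trans (sym (ℤ.*-assoc (f x) (f y) _)) (trans (cong (ℤ._* _) (ℤ.*-comm (f x) (f y))) (ℤ.*-assoc (f y) (f x) _)))
∏ℤ-↭ f (Perm.trans r r′)  = trans (∏ℤ-↭ f r) (∏ℤ-↭ f r′)

∏ℤ-++ : ∀ xs ys → ∏ℤ (xs ++ ys) ≡ ∏ℤ xs ℤ.* ∏ℤ ys
∏ℤ-++ []       ys = sym (ℤ.*-identityˡ _)
∏ℤ-++ (x ∷ xs) ys = trans (cong (x ℤ.*_) (∏ℤ-++ xs ys)) (sym (ℤ.*-assoc x _ _))

Φ₁ : ℕ → ℤ
Φ₁ s = eval (Φ s) 1ℤ

module _ (S : List ℕ) where

  -- The enumeration of S_A^* in (T1) provides the levels as a decidable set: membership in a finite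
  -- list replaces divisibility of polynomials.
  exponents : ℕ → ℕ → Bool
  exponents p i = does (p ^ suc i ∈? S)

  -- The list is descending, so that recursion on its length adds the highest power first, as
  -- `weight` does.
  powers : ℕ → ℕ → List ℕ
  powers p = applyDownFrom (λ i → p ^ suc i)

  ∏ℤ-powers : ∀ {p} → Prime p → ∀ k → ∏ℤ (map Φ₁ (filter (_∈? S) (powers p k))) ≡ + weight p (exponents p) 0 k
  ∏ℤ-powers pp zero = refl
  ∏ℤ-powers {p} pp (suc k) rewrite +-identityʳ k with does (p ^ suc k ∈? S)
  ... | true  = trans (cong₂ ℤ._*_ (eval-Φ-prime-power pp k) (∏ℤ-powers pp k))
                      (trans (sym (ℤ.pos-* p _)) (cong +_ (*-comm p _)))
  ... | false = trans (∏ℤ-powers pp k) (cong +_ (sym (*-identityʳ _)))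

  ^-injective : ∀ {p i j} → Prime p → p ^ i ≡ p ^ j → i ≡ j
  ^-injective {p} {i} {j} pp e with <-cmp i j
  ... | tri< i<j _ _ = ⊥-elim (<-irrefl e (^-monoʳ-< p (ℕ.nonTrivial⇒n>1 p {{prime⇒nonTrivial pp}}) i<j))
  ... | tri≈ _ i≡j _ = i≡j
  ... | tri> _ _ j<i = ⊥-elim (<-irrefl (sym e) (^-monoʳ-< p (ℕ.nonTrivial⇒n>1 p {{prime⇒nonTrivial pp}}) j<i))

  module _ {p q m n} (pp : Prime p) (qp : Prime q) (p≢q : p ≢ q) (unique : Unique S)
           (S⊆powers : ∀ {s} → s ∈ S → s ∈ powers p m ++ powers q n) where

    -- Both lists are free of repetitions and have the same members. The order of the enumeration in
    -- (T1) is arbitrary, and the product is insensitive to it.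
    S↭powers : S ↭ filter (_∈? S) (powers p m ++ powers q n)
    S↭powers = ∼bag⇒↭ (unique∧set⇒bag unique (Unique.filter⁺ (_∈? S) (Unique.++⁺ (unique-powers pp m) (unique-powers qp n) disjoint))
      (mk⇔ (λ s∈S → ∈-filter⁺ (_∈? S) (S⊆powers s∈S) s∈S) (λ s∈ → proj₂ (∈-filter⁻ (_∈? S) {xs = powers p m ++ powers q n} s∈))))
      where
      unique-powers : ∀ {p} → Prime p → ∀ k → Unique (powers p k)
      unique-powers {p} pp k = Unique.applyDownFrom⁺₁ (λ i → p ^ suc i) k λ j<i _ e → <-irrefl (suc-injective (^-injective pp (sym e))) j<i
      disjoint : ∀ {s} → ¬ (s ∈ powers p m × s ∈ powers q n)
      disjoint (s∈p , s∈q) with ∈-applyDownFrom⁻ (λ i → p ^ suc i) s∈p | ∈-applyDownFrom⁻ (λ i → q ^ suc i) s∈q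
      ... | i , _ , refl | j , _ , e = p≢q (prime∣^⇒≡ (suc j) pp qp (subst (p ∣_) e (m∣m*n (p ^ i))))

    ∏ℤ-S : ∏ℤ (map Φ₁ S) ≡ + (weight p (exponents p) 0 m * weight q (exponents q) 0 n)
    ∏ℤ-S = begin
      ∏ℤ (map Φ₁ S)                                                               ≡⟨ ∏ℤ-↭ Φ₁ S↭powers ⟩
      ∏ℤ (map Φ₁ (filter (_∈? S) (powers p m ++ powers q n)))                     ≡⟨ cong (∏ℤ ∘ map Φ₁) (filter-++ (_∈? S) (powers p m) (powers q n)) ⟩
      ∏ℤ (map Φ₁ (filter (_∈? S) (powers p m) ++ filter (_∈? S) (powers q n)))    ≡⟨ cong ∏ℤ (map-++ Φ₁ (filter (_∈? S) (powers p m)) _) ⟩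
      ∏ℤ (map Φ₁ (filter (_∈? S) (powers p m)) ++ map Φ₁ (filter (_∈? S) (powers q n)))  ≡⟨ ∏ℤ-++ (map Φ₁ (filter (_∈? S) (powers p m))) _ ⟩
      ∏ℤ (map Φ₁ (filter (_∈? S) (powers p m))) ℤ.* ∏ℤ (map Φ₁ (filter (_∈? S) (powers q n)))  ≡⟨ cong₂ ℤ._*_ (∏ℤ-powers pp m) (∏ℤ-powers qp n) ⟩
      + weight p (exponents p) 0 m ℤ.* + weight q (exponents q) 0 n               ≡⟨ ℤ.pos-* (weight p (exponents p) 0 m) _ ⟨
      + (weight p (exponents p) 0 m * weight q (exponents q) 0 n)                 ∎
      where open ≡-Reasoning

does⇒ : ∀ {P : Set} (d : Dec P) → does d ≡ true → P
does⇒ (yes x) _ = x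

^∣⇒exponent : ∀ {p q m n i} → Prime p → Prime q → p ≢ q → p ^ i ∣ p ^ m * q ^ n → i ≤ m
^∣⇒exponent {m = m} {n} {i} pp qp p≢q = ^∣-bound {x = i} {m} pp λ p∣qⁿ → p≢q (prime∣^⇒≡ n pp qp p∣qⁿ)

module _ {M} {A : Subset M} {p q m n} (pp : Prime p) (qp : Prime q) (p≢q : p ≢ q) (M≡ : M ≡ p ^ m * q ^ n)
         (t1 : T1 A) (t2 : T2 A) where

  private
    S = proj₁ t1
    K = exponents S p
    L = exponents S q

    sound : ∀ {s} → s ∈ S → s ∈S* A
    sound {s} = Equivalence.to (proj₁ (proj₂ (proj₂ t1)) s)

    K⇒ : ∀ i → K i ≡ true → p ^ suc i ∈S* A
    K⇒ i Ki = sound (does⇒ (p ^ suc i ∈? S) Ki)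

    L⇒ : ∀ j → L j ≡ true → q ^ suc j ∈S* A
    L⇒ j Lj = sound (does⇒ (q ^ suc j ∈? S) Lj)

    K<m : ∀ {i} → p ^ suc i ∣ M → i < m
    K<m {i} d = ^∣⇒exponent {m = m} {n} {suc i} pp qp p≢q (subst (p ^ suc i ∣_) M≡ d)

    L<n : ∀ {j} → q ^ suc j ∣ M → j < n
    L<n {j} d = ^∣⇒exponent {m = n} {m} {suc j} qp pp (p≢q ∘ sym) (subst (q ^ suc j ∣_) (trans M≡ (*-comm (p ^ m) (q ^ n))) d)

    S⊆powers : ∀ {s} → s ∈ S → s ∈ powers S p m ++ powers S q n
    S⊆powers s∈S with sound s∈S
    ... | (r , suc α , rp , _ , refl) , s∣M , _
      with euclidsLemma (p ^ m) (q ^ n) rp (subst (r ∣_) M≡ (∣-trans (m∣m*n (r ^ α)) s∣M))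
    ...   | inj₁ r∣p with refl ← prime∣^⇒≡ m rp pp r∣p = ∈-++⁺ˡ (∈-applyDownFrom⁺ (λ i → p ^ suc i) (K<m {α} s∣M))
    ...   | inj₂ r∣q with refl ← prime∣^⇒≡ n rp qp r∣q = ∈-++⁺ʳ (powers S p m) (∈-applyDownFrom⁺ (λ i → q ^ suc i) (L<n {α} s∣M))

  spectrum : Spectrum A
  spectrum = record
    { p = p ; q = q ; p-prime = pp ; q-prime = qp ; p≢q = p≢q ; m = m ; n = n ; K = K ; L = L
    ; K-bounded = λ i Ki → K<m {i} (proj₁ (proj₂ (K⇒ i Ki)))
    ; L-bounded = λ j Lj → L<n {j} (proj₁ (proj₂ (L⇒ j Lj)))
    ; p-divisor = λ i Ki → proj₂ (proj₂ (K⇒ i Ki))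
    ; q-divisor = λ j Lj → proj₂ (proj₂ (L⇒ j Lj))
    -- (T2) enters here, for one power of each prime; the `subst` removes the final factor 1 from
    -- the product of the list.
    ; pq-divisor = λ i j Ki Lj → subst (λ k → Φ (p ^ suc i * k) ∣ₚ mask A) (*-identityʳ (q ^ suc j))
        (t2 ((p , suc i) ∷ (q , suc j) ∷ []) (λ ()) ((pp , K⇒ i Ki) ∷ (qp , L⇒ j Lj) ∷ []) ((p≢q ∷ []) ∷ [] ∷ []))
    ; size = ℤ.+-injective (trans (proj₂ (proj₂ (proj₂ t1))) (∏ℤ-S S {m = m} {n} pp qp p≢q (proj₁ (proj₂ t1)) S⊆powers))
    }

  -- The prime powers exactly dividing s are p^(α+1) and q^(β+1). Condition (ii) keeps both out of
  -- S_A^*, that is, `α` out of `K` and `β` out of `L`.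
  unsupported⇒⊥ : Nonempty A → ∀ α β → UnsupportedDivisor A (p ^ suc α * q ^ suc β) → ⊥
  unsupported⇒⊥ (a₀ , a₀∈A) α β unsupported = Contradiction.absurd spectrum
    (K<m {α} (∣-trans (m∣m*n (q ^ suc β)) s∣M)) (L<n {β} (∣-trans (n∣m*n (p ^ suc α)) s∣M))
    (dec-false (p ^ suc α ∈? S) λ ∈S → no-prime-powers p (suc α) pp
      (∣-trans (m∣m*n (p ^ α)) (m∣m*n (q ^ suc β)) , m∣m*n (q ^ suc β) , λ d → 1+n≰n (^∣⇒exponent {m = suc α} {suc β} {suc (suc α)} pp qp p≢q d))
      (proj₂ (proj₂ (sound ∈S))))
    (dec-false (q ^ suc β ∈? S) λ ∈S → no-prime-powers q (suc β) qp
      (∣-trans (m∣m*n (q ^ β)) (n∣m*n (p ^ suc α)) , n∣m*n (p ^ suc α)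
      , λ d → 1+n≰n (^∣⇒exponent {m = suc β} {suc α} {suc (suc β)} qp pp (p≢q ∘ sym) (subst (q ^ suc (suc β) ∣_) (*-comm (p ^ suc α) (q ^ suc β)) d)))
      (proj₂ (proj₂ (sound ∈S))))
    Φs∣A a₀ a₀∈A
    where open UnsupportedDivisor unsupported

-- Reduction to M = pᵐqⁿ and s = pʸqᶻ

module _ {M p q} (pp : Prime p) (qp : Prime q) (p≢q : p ≢ q) (p∣M : p ∣ M) (q∣M : q ∣ M) (two : AtMostTwoPrimeDivisors M) where

  two-primes⇒1 : ∀ k .{{_ : NonZero k}} → k ∣ M → ¬ p ∣ k → ¬ q ∣ k → k ≡ 1
  two-primes⇒1 k k∣M p∤k q∤k with k ≟ 1
  ... | yes e = e
  ... | no  ne with prime-divisor k ne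
  ...   | r , rp , r∣k with two (p ∷ q ∷ r ∷ [])
          ((p≢q ∷ (λ { refl → p∤k r∣k }) ∷ []) ∷ ((λ { refl → q∤k r∣k }) ∷ []) ∷ [] ∷ [])
          ((pp , p∣M) ∷ (qp , q∣M) ∷ (rp , ∣-trans r∣k k∣M) ∷ [])
  ...     | s≤s (s≤s ())

  -- Strip off all factors p and then all factors q; a prime dividing what remains would be a third
  -- prime divisor of M.
  two-prime-form : ∀ k .{{_ : NonZero k}} → k ∣ M → ∃₂ λ x y → k ≡ p ^ x * q ^ y
  two-prime-form k k∣M with strip pp k
  ... | x , k′ , refl , p∤k′ with strip qp k′ {{m*n≢0⇒n≢0 (p ^ x)}}
  ...   | y , k″ , refl , q∤k″ with two-primes⇒1 k″ {{m*n≢0⇒n≢0 (q ^ y) {{m*n≢0⇒n≢0 (p ^ x)}}}}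
            (∣-trans (∣-trans (n∣m*n (q ^ y)) (n∣m*n (p ^ x))) k∣M) (p∤k′ ∘ ∣n⇒∣m*n (q ^ y)) q∤k″
  ...     | refl = x , y , cong (p ^ x *_) (*-identityʳ (q ^ y))

-- The power of p exactly dividing s is s itself, so condition (ii) contradicts Φ_s ∣ A.
prime-power-supported : ∀ {M} {A : Subset M} {p s x} → Prime p → p ∣ s → s ≡ p ^ x → ¬ UnsupportedDivisor A s
prime-power-supported {p = p} {x = x} pp p∣s refl unsupported = no-prime-powers p x pp
  (p∣s , ∣-refl , λ d → 1+n≰n (^∣-bound {x = suc x} {m = x} pp (λ p∣1 → ¬prime[1] (subst Prime (∣1⇒≡1 p∣1) pp)) (subst (p ^ suc x ∣_) (sym (*-identityʳ (p ^ x))) d)))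
  Φs∣A
  where open UnsupportedDivisor unsupported

theorem1p12 : (M : ℕ) (A : Subset M) → Nonempty A → T1 A → T2 A → AtMostTwoPrimeDivisors M → (s : ℕ) → ¬ UnsupportedDivisor A s
theorem1p12 zero        A (() , _)
theorem1p12 M@(suc _) A nonempty t1 t2 two zero unsupported with () ← 0∣⇒≡0 (UnsupportedDivisor.s∣M unsupported)
theorem1p12 M@(suc _) A nonempty t1 t2 two s@(suc _) unsupported with prime-divisor s (UnsupportedDivisor.s≢1 unsupported)
... | p , pp , p∣s with strip pp s
...   | x , s′ , s≡ , p∤s′ with s′ ≟ 1
...     | yes refl = prime-power-supported {x = x} pp p∣s (trans s≡ (*-identityʳ (p ^ x))) unsupported
...     | no s′≢1 with prime-divisor s′ {{m*n≢0⇒n≢0 (p ^ x) {{subst NonZero s≡ _}}}} s′≢1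
...       | q , qp , q∣s′ = two-primes (two-prime-form pp qp p≢q p∣M q∣M two M ∣-refl) (two-prime-form pp qp p≢q p∣M q∣M two s s∣M)
  where
  open UnsupportedDivisor unsupported using (s∣M)
  p≢q : p ≢ q
  p≢q refl = p∤s′ q∣s′
  q∣s : q ∣ s
  q∣s = subst (q ∣_) (sym s≡) (∣n⇒∣m*n (p ^ x) q∣s′)
  p∣M : p ∣ M
  p∣M = ∣-trans p∣s s∣M
  q∣M : q ∣ M
  q∣M = ∣-trans q∣s s∣M
  two-primes : ∃₂ (λ m n → M ≡ p ^ m * q ^ n) → ∃₂ (λ y z → s ≡ p ^ y * q ^ z) → ⊥
  -- Both p and q divide `s`, so neither exponent can be 0.
  two-primes _ (zero , z , e) = p≢q (prime∣^⇒≡ z pp qp (subst (p ∣_) (trans e (*-identityˡ (q ^ z))) p∣s))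
  two-primes _ (suc y , zero , e) = p≢q (sym (prime∣^⇒≡ (suc y) qp pp (subst (q ∣_) (trans e (*-identityʳ (p ^ suc y))) q∣s)))
  two-primes (m , n , M≡) (suc y , suc z , e) =
    unsupported⇒⊥ {m = m} {n} pp qp p≢q M≡ t1 t2 nonempty y z (subst (UnsupportedDivisor A) e unsupported)
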